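{- Let $k\ge 1$ be the cache size. Considering all request sequences, with no restriction on which pages may follow which (equivalently, the complete access graph), \[ \mathcal{I}[\mathrm{FIFO},\mathrm{LRU}]=\left[-1+\frac{1}{k},\ \frac{1}{2}-\frac{1}{4k-2}\right]. \]
   Context: Paging: a cache holds at most $k$ pages and is initially empty. A request sequence is a finite sequence of pages. A request to a page in the cache is a hit; otherwise it is a fault, the page is brought into the cache, and if the cache is full some page is evicted first. $\mathcal{A}(I)$ denotes the number of faults of algorithm $\mathcal{A}$ on $I$. LRU evicts the cached page whose most recent request is earliest. FIFO evicts the cached page that entered the cache earliest. Relative interval: for algorithms $\mathcal{A},\mathcal{B}$ and a set of allowed sequences (here all sequences), let $\mathrm{Min}_{\mathcal{A},\mathcal{B}}(n)=\min_{|I|=n}\{\mathcal{A}(I)-\mathcal{B}(I)\}$ and $\mathrm{Max}_{\mathcal{A},\mathcal{B}}(n)=\max_{|I|=n}\{\mathcal{A}(I)-\mathcal{B}(I)\}$, the min/max being over allowed sequences of length $n$; $\mathrm{Min}(\mathcal{A},\mathcal{B})=\liminf_{n\to\infty}\mathrm{Min}_{\mathcal{A},\mathcal{B}}(n)/n$, $\mathrm{Max}(\mathcal{A},\mathcal{B})=\limsup_{n\to\infty}\mathrm{Max}_{\mathcal{A},\mathcal{B}}(n)/n$, and $\mathcal{I}[\mathcal{A},\mathcal{B}]=[\mathrm{Min}(\mathcal{A},\mathcal{B}),\mathrm{Max}(\mathcal{A},\mathcal{B})]$. -}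

module Defs where

open import Data.Bool.Base using (if_then_else_)
open import Data.Integer.Base as ℤ using (ℤ; _⊖_)
open import Data.List.Base using (List; []; _∷_; length; map; filter)
open import Data.List.Extrema.Nat using (argmin)
open import Data.List.Relation.Unary.Any using (any?)
open import Data.Nat.Base as ℕ using (ℕ; suc; NonZero; _*_; _∸_)
open import Data.Nat.Properties using (_≤?_; *-suc)
open import Data.Product.Base using (Σ-syntax; ∃-syntax; _×_)
open import Data.Rational.Base as ℚ using (ℚ; 0ℚ; _/_)
open import Relation.Binary.Definitions using (DecidableEquality)
open import Relation.Binary.PropositionalEquality using (_≡_; subst; sym)
open import Relation.Nullary.Decidable using (does; ¬?)

-- Sequences indexed by the positive integers, so that a(n)/n makes sense.

Sequence : Set
Sequence = (n : ℕ) → .{{_ : NonZero n}} → ℚ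

-- Liminf a q says that lim inf a = q.  The limit superior and inferior of a
-- rational sequence need not exist in ℚ, hence relations and not functions.

Liminf : Sequence → ℚ → Set
Liminf a q = ∀ (ε : ℚ) → 0ℚ ℚ.< ε →
    (∃[ N ] (∀ n → .{{_ : NonZero n}} → N ℕ.≤ n → q ℚ.- ε ℚ.< a n))
  × (∀ N → Σ[ n ∈ ℕ ] Σ[ n≢0 ∈ NonZero n ]
             (N ℕ.≤ n × a n {{n≢0}} ℚ.< q ℚ.+ ε))

Limsup : Sequence → ℚ → Set
Limsup a q = ∀ (ε : ℚ) → 0ℚ ℚ.< ε →
    (∃[ N ] (∀ n → .{{_ : NonZero n}} → N ℕ.≤ n → a n ℚ.< q ℚ.+ ε))
  × (∀ N → Σ[ n ∈ ℕ ] Σ[ n≢0 ∈ NonZero n ]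
             (N ℕ.≤ n × q ℚ.- ε ℚ.< a n {{n≢0}}))

perRequest : (ℕ → ℤ) → Sequence
perRequest f n = f n / n

module Paging {Page : Set} (_≟_ : DecidableEquality Page) where

  Requests : Set
  Requests = List Page

  Cost : Set
  Cost = Requests → ℕ

  -- A cached page with the time at which it entered the cache (for its current
  -- stay) and the time of its most recent request.

  record Entry : Set where
    constructor entry
    field
      page          : Page
      entered       : ℕ
      lastRequested : ℕ

  open Entry public

  Cache : Set
  Cache = List Entry

  -- Remove the page of the entry minimising the given time stamp.  Time stamps
  -- in a reachable cache are pairwise distinct, so there are no ties.

  evict : (Entry → ℕ) → Cache → Cache
  evict stamp []       = []
  evict stamp (e ∷ es) = filter (λ x → ¬? (page x ≟ page victim)) (e ∷ es)
    where victim = argmin stamp e es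

  makeRoom : (Entry → ℕ) → ℕ → Cache → Cache
  makeRoom stamp k c = if does (k ≤? length c) then evict stamp c else c

  touch : ℕ → Page → Cache → Cache
  touch t p = map (λ e → if does (p ≟ page e)
                         then record e { lastRequested = t }
                         else e)

  -- Faults on the remaining requests, at time t with the given cache.

  faultsFrom : (Entry → ℕ) → ℕ → ℕ → Cache → Cost
  faultsFrom stamp k t c []      = 0
  faultsFrom stamp k t c (p ∷ I) =
    if does (any? (λ e → p ≟ page e) c)
    then faultsFrom stamp k (suc t) (touch t p c) I
    else suc (faultsFrom stamp k (suc t) (entry p t t ∷ makeRoom stamp k c) I)

  FIFO : ℕ → Cost
  FIFO k = faultsFrom entered k 0 []

  LRU : ℕ → Cost
  LRU k = faultsFrom lastRequested k 0 []

  difference : Cost → Cost → Requests → ℤ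
  difference A B I = A I ⊖ B I

  IsMin : Cost → Cost → ℕ → ℤ → Set
  IsMin A B n m =
      (∃[ I ] (length I ≡ n × difference A B I ≡ m))
    × (∀ I → length I ≡ n → m ℤ.≤ difference A B I)

  IsMax : Cost → Cost → ℕ → ℤ → Set
  IsMax A B n m =
      (∃[ I ] (length I ≡ n × difference A B I ≡ m))
    × (∀ I → length I ≡ n → difference A B I ℤ.≤ m)

  -- RelativeInterval A B lo hi says that 𝓘[A,B] = [lo , hi].  That the minimum
  -- and maximum are attained for every length is part of the claim, since there
  -- may be infinitely many request sequences of a given length.

  RelativeInterval : Cost → Cost → ℚ → ℚ → Set
  RelativeInterval A B lo hi =
      (Σ[ min ∈ (ℕ → ℤ) ]
         ((∀ n → IsMin A B n (min n)) × Liminf (perRequest min) lo))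
    × (Σ[ max ∈ (ℕ → ℤ) ]
         ((∀ n → IsMax A B n (max n)) × Limsup (perRequest max) hi))

instance
  4k∸2-nonZero : ∀ {k} → .{{_ : NonZero k}} → NonZero (4 * k ∸ 2)
  4k∸2-nonZero {suc k} = subst (λ m → NonZero (m ∸ 2)) (sym (*-suc 4 k)) _

{-# OPTIONS --safe #-}
module Submission where

-- Write F and L for the numbers of faults of FIFO and LRU on n requests.
--
-- The Sleator–Tarjan potential argument bounds the faults of either policy by k times
-- those of the other, up to k.  With L ≤ n this gives k (F − L) ≥ −(k − 1) n − k.  For
-- the upper bound, consider a fault of FIFO that is a hit of LRU.  If the preceding
-- request to that page had been a fault of FIFO, then k other pages would have entered
-- FIFO's cache since, and LRU would have dropped the page.  So the preceding request was
-- a hit of FIFO, which gives F − L ≤ n − F.  Adding k − 1 times this inequality to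
-- F ≤ k L + k yields (2k − 1)(F − L) ≤ (k − 1) n + k.
--
-- Both bounds are attained up to a constant by rounds with one new page each.  For the
-- upper bound, both caches hold the same pages in the same order: hit all but the newest
-- page, the oldest first, then request a new page and repeat the hits.  FIFO evicts each
-- page just before it is requested and faults k times, LRU only once.  For the lower
-- bound, LRU's cache is FIFO's in reverse order: request a new page and then the pages
-- that FIFO still holds, the newest first.  LRU faults k times, FIFO only once.

open import Defs
open import Data.Bool.Base using (true; false; if_then_else_)
open import Data.Integer.Base as ℤ using (ℤ; +_; -[1+_])
import Data.Integer.Properties as ℤ
import Data.Integer.Tactic.RingSolver as ℤ
open import Data.List.Base
  using (List; []; _∷_; [_]; _++_; _∷ʳ_; length; map; filter; take; reverse; replicate;
         applyUpTo; cartesianProductWith; initLast; _∷ʳ′_)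
open import Data.List.Extrema ℤ.≤-totalOrder
  using (argmin; argmax; argmin-all; argmax-all; f[argmin]≤f[xs]; f[xs]≤f[argmax])
import Data.List.Extrema.Nat as ℕ
open import Data.List.Membership.Propositional using (_∈_; _∉_)
open import Data.List.Membership.Propositional.Properties
  using (∈-filter⁺; ∈-filter⁻; ∈-++⁺ˡ; ∈-++⁺ʳ; ∈-++⁻; ∈-map⁺; ∈-map⁻; ∈-applyUpTo⁺;
         ∈-cartesianProductWith⁺; ∈-cartesianProductWith⁻)
open import Data.List.Properties
  using (++-assoc; ++-identityʳ; applyUpTo-∷ʳ; filter-++; filter-all; filter-notAll;
         length-++; length-applyUpTo; length-filter; length-map; length-replicate;
         length-reverse; length-take; map-cong; map-∘; reverse-++; reverse-involutive;
         take-all; take-map; unfold-reverse)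
open import Data.List.Relation.Binary.Permutation.Propositional as ↭
  using (_↭_; ↭-refl; ↭-reflexive; ↭-sym; ↭-trans)
import Data.List.Relation.Binary.Permutation.Propositional.Properties as ↭
import Data.List.Relation.Binary.Permutation.Setoid.Properties as Permutation
open import Data.List.Relation.Binary.Subset.Propositional using (_⊆_)
open import Data.List.Relation.Unary.All as All using (All; []; _∷_)
import Data.List.Relation.Unary.All.Properties as All
open import Data.List.Relation.Unary.AllPairs as AllPairs using (AllPairs; []; _∷_)
import Data.List.Relation.Unary.AllPairs.Properties as AllPairs
open import Data.List.Relation.Unary.Any as Any using (any?; here; there)
import Data.List.Relation.Unary.Any.Properties as Any
open import Data.List.Relation.Unary.Unique.Propositional using (Unique)
open import Data.List.Relation.Unary.Unique.Propositional.Properties as Unique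
  using () renaming (Unique[x∷xs]⇒x∉xs to Unique⇒∉)
open import Data.Nat.Base as ℕ
  using (ℕ; zero; suc; _*_; _∸_; _≤_; _<_; z≤n; s≤s; s≤s⁻¹; NonZero)
open import Data.Nat.Properties as ℕ hiding (_≟_)
import Data.Nat.Tactic.RingSolver as ℕ
open import Data.Product.Base using (Σ-syntax; ∃-syntax; _×_; _,_; proj₁; proj₂)
open import Data.Rational.Base as ℚ using (ℚ; mkℚ; 0ℚ; 1ℚ; ½; toℚᵘ)
import Data.Rational.Properties as ℚ
open import Data.Rational.Unnormalised.Base as ℚᵘ using (mkℚᵘ)
import Data.Rational.Unnormalised.Properties as ℚᵘ
open import Data.Sum.Base using (_⊎_; inj₁; inj₂)
open import Function.Base using (_∘_)
open import Function.Bundles using (_↣_; Injection)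
open import Relation.Binary.Definitions using (DecidableEquality; tri<; tri≈; tri>)
open import Relation.Binary.PropositionalEquality
  using (_≡_; _≢_; refl; sym; trans; cong; cong₂; subst; subst₂; setoid; module ≡-Reasoning)
open import Relation.Nullary using (yes; no; contradiction)
open import Relation.Nullary.Decidable using (does; ¬?; dec-true; dec-false)

take-length-++ : ∀ {A : Set} (xs : List A) {ys n} → length xs ≡ n → take n (xs ++ ys) ≡ xs
take-length-++ []       refl = refl
take-length-++ (x ∷ xs) refl = cong (x ∷_) (take-length-++ xs refl)

-- Demand paging on caches listed as queues.

module Queues {Page : Set} (_≟_ : DecidableEquality Page) where

  open import Data.Nat.Base using (_+_)
  open import Algebra.Properties.CommutativeSemigroup +-commutativeSemigroup
    using (x∙yz≈y∙xz; x∙yz≈yx∙z; x∙yz≈xz∙y; xy∙z≈xz∙y; interchange)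
  open import Data.List.Membership.DecPropositional _≟_ using (_∈?_)

  Pages : Set
  Pages = List Page

  private variable
    p q v x y : Page
    A A′ B B′ c c′ M : Pages
    w : ℕ

  miss : Page → Pages → ℕ
  miss p c = if does (p ∈? c) then 0 else 1

  miss-∈ : p ∈ c → miss p c ≡ 0
  miss-∈ {p} {c} p∈c rewrite dec-true (p ∈? c) p∈c = refl

  miss-∉ : p ∉ c → miss p c ≡ 1
  miss-∉ {p} {c} p∉c rewrite dec-false (p ∈? c) p∉c = refl

  miss≤1 : ∀ p c → miss p c ≤ 1
  miss≤1 p c with p ∈? c
  ... | yes _ = z≤n
  ... | no _  = ≤-refl

  remove : Page → Pages → Pages
  remove p = filter (λ x → ¬? (x ≟ p))

  ∈-remove⁺ : x ∈ c → x ≢ p → x ∈ remove p c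
  ∈-remove⁺ = ∈-filter⁺ _

  ∈-remove⁻ : x ∈ remove p c → x ∈ c × x ≢ p
  ∈-remove⁻ = ∈-filter⁻ _

  remove-∉ : p ∉ c → remove p c ≡ c
  remove-∉ p∉c = filter-all _ (All.tabulate λ { x∈c refl → p∉c x∈c })

  length-remove : p ∈ c → length (remove p c) < length c
  length-remove p∈c = filter-notAll _ _ (Any.map (λ p≡x x≢p → x≢p (sym p≡x)) p∈c)

  ⊆-∷-remove : ∀ p c → c ⊆ p ∷ remove p c
  ⊆-∷-remove p c {x} x∈c with x ≟ p
  ... | yes refl = here refl
  ... | no x≢p   = there (∈-remove⁺ x∈c x≢p)

  remove-⊆ : remove p c ⊆ c
  remove-⊆ = proj₁ ∘ ∈-remove⁻

  ∈-take : ∀ w → take w c ⊆ c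
  ∈-take {_ ∷ c} (suc w) (here eq)  = here eq
  ∈-take {_ ∷ c} (suc w) (there x∈) = there (∈-take w x∈)

  Unique-∷ : x ∉ c → Unique c → Unique (x ∷ c)
  Unique-∷ x∉c c! = All.tabulate (λ { y∈c refl → x∉c y∈c }) ∷ c!

  -- Induction on `A`: removing its head from `B` shortens `B` and, as `A` has no repetitions, keeps
  -- the tail of `A` inside.
  pigeonhole : Unique A → A ⊆ B → length A ≤ length B
  pigeonhole []       A⊆B = z≤n
  pigeonhole (x∉A ∷ A!) A⊆B = <-≤-trans
    (s≤s (pigeonhole A! λ y∈A → ∈-remove⁺ (A⊆B (there y∈A)) (λ { refl → All.lookup x∉A y∈A refl })))
    (length-remove (A⊆B (here refl)))

  -- A cache of suc w slots is listed with the newest page first for FIFO and with the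
  -- most recently requested page first for LRU, so that either policy evicts the last
  -- page of a full cache.

  data Step (w : ℕ) (p : Page) (c : Pages) : Pages → Set where
    keep  : p ∈ c → Step w p c c
    front : p ∈ c → Step w p c (p ∷ remove p c)
    load  : p ∉ c → Step w p c (p ∷ take w c)

  Policy : Set
  Policy = Page → Pages → Pages

  fifo lru : ℕ → Policy
  fifo w p c = if does (p ∈? c) then c else p ∷ take w c
  lru  w p c = if does (p ∈? c) then p ∷ remove p c else p ∷ take w c

  -- All that the competitive bound and the cycling argument use of a policy, so that FIFO and LRU
  -- can each take either role.
  Demand : ℕ → Policy → Set
  Demand w s = ∀ p c → Step w p c (s p c)

  fifo-step : ∀ w → Demand w (fifo w)
  fifo-step w p c with p ∈? c
  ... | yes p∈c = keep p∈c
  ... | no p∉c  = load p∉c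

  lru-step : ∀ w → Demand w (lru w)
  lru-step w p c with p ∈? c
  ... | yes p∈c = front p∈c
  ... | no p∉c  = load p∉c

  run : Policy → Pages → Pages → Pages
  run s c []      = c
  run s c (p ∷ I) = run s (s p c) I

  faults : Policy → Pages → Pages → ℕ
  faults s c []      = 0
  faults s c (p ∷ I) = miss p c + faults s (s p c) I

  step-∋ : Step w p c c′ → p ∈ c′
  step-∋ (keep p∈c) = p∈c
  step-∋ (front _)  = here refl
  step-∋ (load _)   = here refl

  step-⊆ : Step w p c c′ → c′ ⊆ p ∷ c
  step-⊆ (keep _)  x∈         = there x∈
  step-⊆ (front _) (here eq)  = here eq
  step-⊆ (front _) (there x∈) = there (remove-⊆ x∈)
  step-⊆ (load _)  (here eq)  = here eq
  step-⊆ {w} (load _) (there x∈) = there (∈-take w x∈)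

  step-Unique : Step w p c c′ → Unique c → Unique c′
  step-Unique (keep _)  c! = c!
  step-Unique {c = c} (front _) c! = Unique-∷ (λ p∈ → proj₂ (∈-remove⁻ {c = c} p∈) refl) (Unique.filter⁺ _ c!)
  step-Unique {w} (load p∉c) c! = Unique-∷ (p∉c ∘ ∈-take w) (Unique.take⁺ w c!)

  step-length : Step w p c c′ → length c ≤ suc w → length c′ ≤ suc w
  step-length (keep _)    c≤ = c≤
  step-length (front p∈c) c≤ = ≤-trans (length-remove p∈c) c≤
  step-length {w} {c = c} (load _) c≤ =
    s≤s (≤-trans (≤-reflexive (length-take w c)) (m⊓n≤m w (length c)))

  step-hit : p ∈ c → Step w p c c′ → c ⊆ c′
  step-hit _   (keep _)   = λ x∈ → x∈
  step-hit _   (front _)  = ⊆-∷-remove _ _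
  step-hit p∈c (load p∉c) = contradiction p∈c p∉c

  take-loses-≤1 : ∀ w (p : Page) c → length c ≤ suc w → ∃[ v ] c ⊆ v ∷ take w c
  -- No page is lost here, and `p` is a placeholder for the lost one.
  take-loses-≤1 w p []      _ = p , λ ()
  take-loses-≤1 zero p (x ∷ []) _ = x , λ x∈ → x∈
  take-loses-≤1 zero p (x ∷ _ ∷ _) (s≤s ())
  take-loses-≤1 (suc w) p (x ∷ c) (s≤s c≤) with take-loses-≤1 w p c c≤
  ... | v , c⊆ = v , λ
    { (here eq)  → there (here eq)
    ; (there y∈) → case-there (c⊆ y∈) }
    where
    case-there : ∀ {y} → y ∈ v ∷ take w c → y ∈ v ∷ x ∷ take w c
    case-there (here eq)  = here eq
    case-there (there y∈) = there (there y∈)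

  step-loses-≤1 : length c ≤ suc w → Step w p c c′ → ∃[ v ] c ⊆ v ∷ c′
  step-loses-≤1 {p = p} _ (keep _)  = p , there
  step-loses-≤1 {p = p} _ (front _) = p , there ∘ ⊆-∷-remove _ _
  step-loses-≤1 {c = c} {w = w} {p = p} c≤ (load _) with take-loses-≤1 w p c c≤
  ... | v , c⊆ = v , λ y∈ → aux (c⊆ y∈)
    where
    aux : ∀ {y} → y ∈ v ∷ take w c → y ∈ v ∷ p ∷ take w c
    aux (here eq)  = here eq
    aux (there y∈) = there (there y∈)

  -- The competitive bound between any two demand policies.

  -- The Sleator–Tarjan potential: a page of A that is not in B weighs the number
  -- of further faults after which A drops it.  The unused slots of A are added.

  Φ : ℕ → Pages → Pages → ℕ
  Φ w       B []      = w
  Φ zero    B (x ∷ A) = 0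
  Φ (suc w) B (x ∷ A) = suc w * miss x B + Φ w B A

  Φ-mono : ∀ w B A → Φ w B A ≤ Φ (suc w) B A
  Φ-mono w       B []      = n≤1+n w
  Φ-mono zero    B (x ∷ A) = z≤n
  Φ-mono (suc w) B (x ∷ A) = +-mono-≤ (*-monoˡ-≤ (miss x B) (n≤1+n (suc w))) (Φ-mono w B A)

  Φ-drop : ∀ w B A → Φ w B A < Φ (suc w) B A ⊎ (suc w ≤ length A × take (suc w) A ⊆ B)
  Φ-drop w B []      = inj₁ ≤-refl
  Φ-drop w B (x ∷ A) with x ∈? B
  Φ-drop zero    B (x ∷ A) | yes x∈B = inj₂ (s≤s z≤n , λ { (here refl) → x∈B ; (there ()) })
  Φ-drop zero    B (x ∷ A) | no x∉B  = inj₁ (s≤s z≤n)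
  Φ-drop (suc w) B (x ∷ A) | no x∉B rewrite miss-∉ x∉B =
    inj₁ (s≤s (s≤s (+-monoʳ-≤ (w * 1) (Φ-mono w B A))))
  Φ-drop (suc w) B (x ∷ A) | yes x∈B with Φ-drop w B A
  ... | inj₁ lt rewrite miss-∈ x∈B | *-zeroʳ w = inj₁ lt
  ... | inj₂ (w< , A⊆B) = inj₂ (s≤s w< , λ { (here refl) → x∈B ; (there y∈) → A⊆B y∈ })

  Φ-anti : ∀ w → (∀ {x} → x ∈ A → x ∈ B → x ∈ B′) → Φ w B′ A ≤ Φ w B A
  Φ-anti {[]}    w       B⊆B′ = ≤-refl
  Φ-anti {x ∷ A} zero    B⊆B′ = z≤n
  Φ-anti {x ∷ A} {B} {B′} (suc w) B⊆B′ =
    +-mono-≤ (*-monoʳ-≤ (suc w) miss≤) (Φ-anti w (B⊆B′ ∘ there))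
    where
    miss≤ : miss x B′ ≤ miss x B
    miss≤ with x ∈? B
    ... | yes x∈B = ≤-reflexive (miss-∈ (B⊆B′ (here refl) x∈B))
    ... | no _    = miss≤1 x B′

  -- Only `v` can become missing; it occurs in `A` at most once, with weight at most `w`.
  Φ-lose : ∀ w → Unique A → B ⊆ v ∷ B′ → Φ w B′ A ≤ w + Φ w B A
  Φ-lose {[]}    w       _  _ = m≤m+n w w
  Φ-lose {x ∷ A} zero    _  _ = z≤n
  Φ-lose {x ∷ A} {B} {v} {B′} (suc w) (x∉A ∷ A!) B⊆ with x ∈? B′
  ... | yes _ rewrite *-zeroʳ w = ≤-trans (Φ-lose w A! B⊆)
    (+-mono-≤ (n≤1+n w) (m≤n+m (Φ w B A) (suc w * miss x B)))
  ... | no x∉B′ with x ∈? B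
  ... | no _ = +-mono-≤ (≤-reflexive (*-identityʳ (suc w)))
    (≤-trans (Φ-lose w A! B⊆) (+-monoˡ-≤ (Φ w B A) (≤-trans (n≤1+n w) (≤-reflexive (sym (*-identityʳ (suc w)))))))
  ... | yes x∈B with B⊆ x∈B
  ... | there x∈B′ = contradiction x∈B′ x∉B′
  ... | here refl rewrite *-zeroʳ w | *-identityʳ w = +-monoʳ-≤ (suc w) (Φ-anti w λ y∈A y∈B → aux y∈A (B⊆ y∈B))
    where
    aux : ∀ {y} → y ∈ A → y ∈ x ∷ B′ → y ∈ B′
    aux y∈A (here refl) = contradiction refl (All.lookup x∉A y∈A)
    aux y∈A (there y∈B) = y∈B

  -- When LRU moves `p` to the front, the pages ahead of `p` slip back one place and lose a unit of
  -- weight, while those behind it keep their places.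
  Φ-remove : ∀ w → Unique A → p ∈ A → Φ w B (remove p A) ≤ Φ (suc w) B A
  Φ-remove {x ∷ A} {p} {B} w (x∉A ∷ A!) p∈A with x ≟ p
  ... | yes refl rewrite remove-∉ {c = A} (λ x∈A → All.lookup x∉A x∈A refl) =
    m≤n+m (Φ w B A) (suc w * miss x B)
  Φ-remove {x ∷ A} {p} w (x∉A ∷ A!) (here refl) | no x≢p = contradiction refl x≢p
  Φ-remove {x ∷ A} {p} zero (x∉A ∷ A!) (there p∈A) | no x≢p = z≤n
  Φ-remove {x ∷ A} {p} {B} (suc w) (x∉A ∷ A!) (there p∈A) | no x≢p =
    +-mono-≤ (*-monoˡ-≤ (miss x B) (n≤1+n (suc w))) (Φ-remove w A! p∈A)

  Φ-take : ∀ w A {B} → Φ w B (take w A) ≡ Φ w B A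
  Φ-take zero    []      = refl
  Φ-take (suc w) []      = refl
  Φ-take zero    (x ∷ A) = refl
  Φ-take (suc w) (x ∷ A) = cong (λ m → _ + m) (Φ-take w A)

  Φ-hit : Step w p A A′ → Unique A → p ∈ A → p ∈ B → Φ (suc w) B A′ ≤ Φ (suc w) B A
  Φ-hit (keep _) _ _ _ = ≤-refl
  Φ-hit {w} (front p∈A) A! _ p∈B rewrite miss-∈ p∈B | *-zeroʳ w = Φ-remove w A! p∈A
  Φ-hit (load p∉A) _ p∈A _ = contradiction p∈A p∉A

  Φ-fault : Step w p A A′ → p ∉ A → p ∈ B → Φ (suc w) B A′ ≡ Φ w B A
  Φ-fault (keep p∈A)  p∉A _ = contradiction p∈A p∉A
  Φ-fault (front p∈A) p∉A _ = contradiction p∈A p∉A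
  Φ-fault {w} {A = A} (load _) _ p∈B rewrite miss-∈ p∈B | *-zeroʳ w = Φ-take w A

  -- A hit of `B` loses no page of `B`. A fault of `B` loses at most one, which raises the potential
  -- by at most `suc w`, or by at most `w` when `A` faults too and its pages slip back; the
  -- remaining unit then covers the fault of `A`. When `A` alone faults, the potential has to fall.
  Φ-step : Step w p A A′ → Step w p B B′ →
           Unique A → length A ≤ suc w → length B ≤ suc w →
           miss p A + Φ (suc w) B′ A′ ≤ suc w * miss p B + Φ (suc w) B A
  Φ-step {w} {p} {A} {A′} {B} {B′} sA sB A! A≤ B≤ with p ∈? A | p ∈? B
  ... | yes p∈A | yes p∈B rewrite *-zeroʳ w =
    ≤-trans (Φ-hit sA A! p∈A (step-∋ sB)) (Φ-anti {A} (suc w) λ _ → step-hit p∈B sB)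
  ... | yes p∈A | no _ rewrite *-identityʳ w =
    ≤-trans (Φ-hit sA A! p∈A (step-∋ sB)) (Φ-lose (suc w) A! (proj₂ (step-loses-≤1 B≤ sB)))
  ... | no p∉A | no _ rewrite *-identityʳ w | Φ-fault sA p∉A (step-∋ sB) =
    s≤s (≤-trans (Φ-lose w A! (proj₂ (step-loses-≤1 B≤ sB))) (+-monoʳ-≤ w (Φ-mono w B A)))
  ... | no p∉A | yes p∈B rewrite *-zeroʳ w | Φ-fault sA p∉A (step-∋ sB) with Φ-drop w B′ A
  ... | inj₁ lt = ≤-trans lt (Φ-anti {A} (suc w) λ _ → step-hit p∈B sB)
  -- Otherwise the first `suc w` pages of `A` all lie in `B′`, and so does `p`, which is none of
  -- them: one page too many.
  ... | inj₂ (w< , A⊆B′) = contradiction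
    (≤-trans (pigeonhole (Unique-∷ (p∉A ∘ ∈-take (suc w)) (Unique.take⁺ (suc w) A!))
                         λ { (here refl) → step-∋ sB ; (there x∈) → A⊆B′ x∈ })
             (step-length sB B≤))
    (<⇒≱ (s≤s (≤-reflexive (sym (trans (length-take (suc w) A) (m≤n⇒m⊓n≡m w<))))))

  -- The amortised inequality `Φ-step` summed over the requests. For an empty `A` the initial
  -- potential is `suc w`, which becomes the additive constant of the bound.
  competitive : ∀ w {s t} →
    Demand w s → Demand w t →
    ∀ I {A B} → Unique A → length A ≤ suc w → length B ≤ suc w →
    faults s A I ≤ suc w * faults t B I + Φ (suc w) B A
  competitive w s-step t-step [] _ _ _ = z≤n
  competitive w {s} {t} s-step t-step (p ∷ I) {A} {B} A! A≤ B≤ = begin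
    miss p A + faults s A⁺ I
      ≤⟨ +-monoʳ-≤ (miss p A) (competitive w s-step t-step I
           (step-Unique sA A!) (step-length sA A≤) (step-length sB B≤)) ⟩
    miss p A + (suc w * faults t B⁺ I + Φ (suc w) B⁺ A⁺)
      ≡⟨ x∙yz≈y∙xz (miss p A) (suc w * faults t B⁺ I) _ ⟩
    suc w * faults t B⁺ I + (miss p A + Φ (suc w) B⁺ A⁺)
      ≤⟨ +-monoʳ-≤ (suc w * faults t B⁺ I) (Φ-step sA sB A! A≤ B≤) ⟩
    suc w * faults t B⁺ I + (suc w * miss p B + Φ (suc w) B A)
      ≡⟨ x∙yz≈yx∙z (suc w * faults t B⁺ I) (suc w * miss p B) _ ⟩
    suc w * miss p B + suc w * faults t B⁺ I + Φ (suc w) B A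
      ≡⟨ cong (_+ Φ (suc w) B A) (*-distribˡ-+ (suc w) (miss p B) _) ⟨
    suc w * (miss p B + faults t B⁺ I) + Φ (suc w) B A ∎
    where
    open ≤-Reasoning
    A⁺ = s p A
    B⁺ = t p B
    sA = s-step p A
    sB = t-step p B

  -- Which faults of FIFO can be hits of LRU.

  -- Ahead in the list means more recent: a later entry for FIFO, a later request for LRU.
  data Before (y x : Page) : Pages → Set where
    now   : x ∈ c → Before y x (y ∷ c)
    later : Before y x c → Before y x (q ∷ c)

  Before⇒∈ˡ : Before y x c → y ∈ c
  Before⇒∈ˡ (now _)   = here refl
  Before⇒∈ˡ (later b) = there (Before⇒∈ˡ b)

  Before⇒∈ʳ : Before y x c → x ∈ c
  Before⇒∈ʳ (now x∈c) = there x∈c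
  Before⇒∈ʳ (later b) = there (Before⇒∈ʳ b)

  Before-take⁻ : ∀ w → Before y x (take w c) → Before y x c
  Before-take⁻ {c = _ ∷ _} (suc w) (now x∈)  = now (∈-take w x∈)
  Before-take⁻ {c = _ ∷ _} (suc w) (later b) = later (Before-take⁻ w b)

  Before-take⁺ : ∀ w → Unique c → x ∈ take w c → Before y x c → Before y x (take w c)
  Before-take⁺ (suc w) (z∉c ∷ c!) (here refl) (now x∈c) = contradiction refl (All.lookup z∉c x∈c)
  Before-take⁺ (suc w) (z∉c ∷ c!) (here refl) (later b) = contradiction refl (All.lookup z∉c (Before⇒∈ʳ b))
  Before-take⁺ (suc w) (z∉c ∷ c!) (there x∈)  (now _)   = now x∈
  Before-take⁺ (suc w) (z∉c ∷ c!) (there x∈)  (later b) = later (Before-take⁺ w c! x∈ b)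

  Before-remove : x ≢ p → y ≢ p → Before y x c → Before y x (remove p c)
  Before-remove {p = p} {y = y} x≢p y≢p (now x∈c) with y ≟ p
  ... | yes y≡p = contradiction y≡p y≢p
  ... | no _    = now (∈-remove⁺ x∈c x≢p)
  Before-remove {p = p} x≢p y≢p (later {q = q} b) with q ≟ p
  ... | yes _ = Before-remove x≢p y≢p b
  ... | no _  = later (Before-remove x≢p y≢p b)

  ∉take⇒Before : ∀ w → x ∈ c → x ∉ take w c → y ∈ take w c → Before y x c
  ∉take⇒Before (suc w) (here refl) x∉ _          = contradiction (here refl) x∉
  ∉take⇒Before (suc w) (there x∈c) x∉ (here refl) = now x∈c
  ∉take⇒Before (suc w) (there x∈c) x∉ (there y∈) = later (∉take⇒Before w x∈c (x∉ ∘ there) y∈)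

  ∉take⇒full : ∀ w → x ∈ c → x ∉ take w c → length (take w c) ≡ w
  ∉take⇒full zero    _           _  = refl
  ∉take⇒full (suc w) (here refl) x∉ = contradiction (here refl) x∉
  ∉take⇒full (suc w) (there x∈c) x∉ = cong suc (∉take⇒full w x∈c (x∉ ∘ there))

  -- Since LRU drops pages from the back, the survival of `x` implies that of every page ahead of
  -- it; the requested page goes ahead of all others.
  Before-lru : Unique B → x ≢ p → x ∈ lru w p B → y ≡ p ⊎ Before y x B → Before y x (lru w p B)
  Before-lru {B} {x} {p} {w} {y} B! x≢p x∈ y≡p⊎b with p ∈? B | x∈ | y≡p⊎b
  ... | yes _ | here x≡p | _         = contradiction x≡p x≢p
  ... | no _  | here x≡p | _         = contradiction x≡p x≢p
  ... | yes _ | there x∈ | inj₁ refl = now x∈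
  ... | no _  | there x∈ | inj₁ refl = now x∈
  ... | no _  | there x∈ | inj₂ b    = later (Before-take⁺ w B! x∈ b)
  ... | yes _ | there x∈ | inj₂ b with y ≟ p
  ...   | yes refl = now x∈
  ...   | no y≢p   = later (Before-remove x≢p y≢p b)

  -- M holds the pages whose most recent request was a hit of FIFO (cache A).  For
  -- any other page of A, the pages ahead of it in A entered after its most recent
  -- request, so LRU (cache B) cannot drop them before it.

  record Marking (M A B : Pages) : Set where
    field
      evicted : x ∈ B → x ∉ A → x ∈ M
      ordered : x ∉ M → x ∈ B → Before y x A → Before y x B

  open Marking

  -- A repeated hit adds a further copy of `p`, so that every hit of FIFO lengthens the list by
  -- exactly one; a fault clears all copies.
  mark : ℕ → Page → Pages → Pages → Pages
  mark w p A M = if does (p ∈? A) then p ∷ M else remove p M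

  ∈-step : Step w p c c′ → x ≢ p → x ∈ c′ → x ∈ c
  ∈-step s x≢p x∈ with step-⊆ s x∈
  ... | here x≡p = contradiction x≡p x≢p
  ... | there x∈c = x∈c

  -- On a hit FIFO keeps its order, and the only page that LRU moves forward becomes marked. On a
  -- fault `p` goes to the front of both queues, and the critical case is a page that FIFO evicts
  -- while LRU keeps it.
  marking-step : ∀ w p → Unique A → Unique B → length B ≤ suc w →
                 Marking M A B → Marking (mark w p A M) (fifo w p A) (lru w p B)
  marking-step {A} {B} {M} w p A! B! B≤ m with p ∈? A
  ... | yes p∈A = record { evicted = evicted′ ; ordered = ordered′ }
    where
    evicted′ : x ∈ lru w p B → x ∉ A → x ∈ p ∷ M
    evicted′ {x} x∈ x∉A with x ≟ p
    ... | yes refl = here refl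
    ... | no x≢p   = there (evicted m (∈-step (lru-step w p B) x≢p x∈) x∉A)
    ordered′ : x ∉ p ∷ M → x ∈ lru w p B → Before y x A → Before y x (lru w p B)
    ordered′ x∉ x∈ b = Before-lru B! (x∉ ∘ here) x∈
      (inj₂ (ordered m (x∉ ∘ there) (∈-step (lru-step w p B) (x∉ ∘ here) x∈) b))
  ... | no p∉A = record { evicted = evicted′ ; ordered = ordered′ }
    where
    ordered′ : x ∉ remove p M → x ∈ lru w p B → Before y x (p ∷ take w A) → Before y x (lru w p B)
    ordered′ x∉ x∈ (now x∈A) = Before-lru B! (λ { refl → p∉A (∈-take w x∈A) }) x∈ (inj₁ refl)
    ordered′ {x} x∉ x∈ (later b) = Before-lru B! x≢p x∈
      (inj₂ (ordered m (λ x∈M → x∉ (∈-remove⁺ x∈M x≢p)) (∈-step (lru-step w p B) x≢p x∈) b′))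
      where
      b′ = Before-take⁻ w b
      x≢p : x ≢ p
      x≢p refl = p∉A (Before⇒∈ʳ b′)
    evicted′ : x ∈ lru w p B → x ∉ p ∷ take w A → x ∈ remove p M
    evicted′ {x} x∈ x∉ with x ∈? M | x ∈? A
    ... | yes x∈M | _      = ∈-remove⁺ x∈M (x∉ ∘ here)
    ... | no _    | no x∉A =
      ∈-remove⁺ (evicted m (∈-step (lru-step w p B) (x∉ ∘ here) x∈) x∉A) (x∉ ∘ here)
    -- Suppose the evicted page `x` is unmarked. The `w` pages ahead of it in `A` are ahead of it in
    -- `B` as well, so LRU would hold them together with `x` and `p`: `suc (suc w)` pages.
    ... | no x∉M  | yes x∈A = contradiction
      (≤-trans (pigeonhole (Unique-∷ x∉ (Unique-∷ (p∉A ∘ ∈-take w) (Unique.take⁺ w A!))) ⊆lru)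
               (step-length (lru-step w p B) B≤))
      (<⇒≱ (s≤s (s≤s (≤-reflexive (sym (∉take⇒full w x∈A (x∉ ∘ there)))))))
      where
      ⊆lru : x ∷ p ∷ take w A ⊆ lru w p B
      ⊆lru (here refl) = x∈
      ⊆lru (there (here refl)) = step-∋ (lru-step w p B)
      ⊆lru (there (there y∈)) = Before⇒∈ˡ (Before-lru B! (x∉ ∘ here) x∈
        (inj₂ (ordered m x∉M (∈-step (lru-step w p B) (x∉ ∘ here) x∈)
          (∉take⇒Before w x∈A (x∉ ∘ there) y∈))))

  -- The number of marks is a potential. A hit of FIFO pays for its mark with the unit of the
  -- request. A fault of FIFO costs two units: one comes from the request, the other from the fault
  -- of LRU or, if LRU hits, from a mark of `p`, which exists by `evicted`.
  mark-length : ∀ w p → Marking M A B →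
                miss p A + miss p A + length (mark w p A M) ≤ suc (miss p B) + length M
  mark-length {M} {A} {B} w p m with p ∈? A | p ∈? B
  ... | yes _  | yes _  = ≤-refl
  ... | yes _  | no _   = n≤1+n _
  ... | no p∉A | yes p∈B = s≤s (length-remove (evicted m p∈B p∉A))
  ... | no _   | no _   = s≤s (s≤s (length-filter _ M))

  fifo-hits : ∀ w I {M A B} → Unique A → Unique B → length B ≤ suc w → Marking M A B →
              faults (fifo w) A I + faults (fifo w) A I ≤ length I + faults (lru w) B I + length M
  fifo-hits w [] _ _ _ _ = z≤n
  fifo-hits w (p ∷ I) {M} {A} {B} A! B! B≤ m = begin
    miss p A + F + (miss p A + F)
      ≡⟨ interchange (miss p A) F (miss p A) F ⟩
    miss p A + miss p A + (F + F)
      ≤⟨ +-monoʳ-≤ (miss p A + miss p A) (fifo-hits w I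
           (step-Unique (fifo-step w p A) A!) (step-Unique sB B!) (step-length sB B≤)
           (marking-step w p A! B! B≤ m)) ⟩
    miss p A + miss p A + (length I + L + length (mark w p A M))
      ≡⟨ x∙yz≈xz∙y (miss p A + miss p A) (length I + L) _ ⟩
    miss p A + miss p A + length (mark w p A M) + (length I + L)
      ≤⟨ +-monoˡ-≤ (length I + L) (mark-length w p m) ⟩
    suc (miss p B) + length M + (length I + L)
      ≡⟨ xy∙z≈xz∙y (suc (miss p B)) (length M) (length I + L) ⟩
    suc (miss p B) + (length I + L) + length M
      ≡⟨ cong (_+ length M) (cong suc (x∙yz≈y∙xz (miss p B) (length I) L)) ⟩
    suc (length I) + (miss p B + L) + length M ∎
    where
    open ≤-Reasoning
    F = faults (fifo w) (fifo w p A) I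
    L = faults (lru w) (lru w p B) I
    sB = lru-step w p B

-- Request sequences that attain the bounds.

module RequestSequences {Page : Set} (_≟_ : DecidableEquality Page) where

  open import Data.Nat.Base using (_+_)
  open Queues _≟_
  open import Data.List.Membership.DecPropositional _≟_ using (_∈?_)

  private variable
    p z : Page
    A B c c′ : Pages
    w : ℕ

  Unique-↭ : A ↭ B → Unique A → Unique B
  Unique-↭ A↭B = Permutation.Unique-resp-↭ (setoid Page) (↭.↭⇒↭ₛ A↭B)

  Unique-∷ʳ : Unique (c ∷ʳ z) → Unique (z ∷ c)
  Unique-∷ʳ = Unique-↭ (↭-sym (↭.∷↭∷ʳ _ _))

  faults≤length : ∀ s c I → faults s c I ≤ length I
  faults≤length s c []      = z≤n
  faults≤length s c (p ∷ I) = +-mono-≤ (miss≤1 p c) (faults≤length s (s p c) I)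

  run-++ : ∀ s I J → run s c (I ++ J) ≡ run s (run s c I) J
  run-++ s []      J = refl
  run-++ s (p ∷ I) J = run-++ s I J

  faults-++ : ∀ s I J → faults s c (I ++ J) ≡ faults s c I + faults s (run s c I) J
  faults-++ s []      J = refl
  faults-++ {c} s (p ∷ I) J rewrite faults-++ {s p c} s I J =
    sym (+-assoc (miss p c) _ _)

  step-load : p ∉ c → Step w p c c′ → c′ ≡ p ∷ take w c
  step-load p∉c (keep p∈c)  = contradiction p∈c p∉c
  step-load p∉c (front p∈c) = contradiction p∈c p∉c
  step-load p∉c (load _)    = refl

  fifo-hit : ∀ w → p ∈ c → fifo w p c ≡ c
  fifo-hit {p} {c} w p∈c with p ∈? c
  ... | yes _  = refl
  ... | no p∉c = contradiction p∈c p∉c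

  lru-hit : ∀ w → p ∈ c → lru w p c ≡ p ∷ remove p c
  lru-hit {p} {c} w p∈c with p ∈? c
  ... | yes _  = refl
  ... | no p∉c = contradiction p∈c p∉c

  remove-self : remove z (z ∷ B) ≡ remove z B
  remove-self {z} with z ≟ z
  ... | yes _  = refl
  ... | no z≢z = contradiction refl z≢z

  remove-middle : ∀ A {B} → Unique (z ∷ A ++ B) → remove z (A ++ z ∷ B) ≡ A ++ B
  remove-middle {z} A {B} z! = begin
    remove z (A ++ z ∷ B)            ≡⟨ filter-++ _ A (z ∷ B) ⟩
    remove z A ++ remove z (z ∷ B)   ≡⟨ cong (remove z A ++_) remove-self ⟩
    remove z A ++ remove z B         ≡⟨ cong₂ _++_ (remove-∉ (Unique⇒∉ z! ∘ ∈-++⁺ˡ))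
                                               (remove-∉ (Unique⇒∉ z! ∘ ∈-++⁺ʳ A)) ⟩
    A ++ B                           ∎
    where open ≡-Reasoning

  fifo-hits-run : ∀ w {c} I → I ⊆ c → run (fifo w) c I ≡ c × faults (fifo w) c I ≡ 0
  fifo-hits-run w []      I⊆c = refl , refl
  fifo-hits-run w (p ∷ I) I⊆c rewrite fifo-hit w (I⊆c (here refl)) | miss-∈ (I⊆c (here refl)) =
    fifo-hits-run w I (I⊆c ∘ there)

  -- Every request is to the page at the back of the queue, so each hit rotates the queue by one
  -- place.
  lru-hits-rotate : ∀ w A u → Unique (A ++ reverse u) →
    run (lru w) (A ++ reverse u) u ≡ reverse u ++ A × faults (lru w) (A ++ reverse u) u ≡ 0
  lru-hits-rotate w A []      _  = ++-identityʳ A , refl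
  lru-hits-rotate w A (z ∷ u) c!
    rewrite unfold-reverse z u | sym (++-assoc A (reverse u) [ z ])
          | lru-hit {z} {(A ++ reverse u) ++ [ z ]} w (∈-++⁺ʳ (A ++ reverse u) (here refl))
          | miss-∈ {z} {(A ++ reverse u) ++ [ z ]} (∈-++⁺ʳ (A ++ reverse u) (here refl))
          | remove-middle (A ++ reverse u) {[]}
              (subst (λ c → Unique (z ∷ c)) (sym (++-identityʳ _)) (Unique-∷ʳ c!))
          | ++-identityʳ (A ++ reverse u)
          | ++-assoc (reverse u) [ z ] A = lru-hits-rotate w (z ∷ A) u (Unique-∷ʳ c!)

  lru-hits-reverse : ∀ w A u → Unique (A ++ u) → run (lru w) (A ++ u) u ≡ reverse u ++ A
  lru-hits-reverse w A []      _  = ++-identityʳ A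
  lru-hits-reverse w A (z ∷ u) c!
    rewrite lru-hit w (∈-++⁺ʳ A {z ∷ u} (here refl))
          | remove-middle A {u} (Unique-↭ (↭.shift z A u) c!)
          | unfold-reverse z u | ++-assoc (reverse u) [ z ] A =
    lru-hits-reverse w (z ∷ A) u (Unique-↭ (↭.shift z A u) c!)

  module _ {w : ℕ} {s : Policy} (s-step : Demand w s) where

    load-all : ∀ u A → length u + length A ≤ suc w → Unique (A ++ u) → run s A u ≡ reverse u ++ A
    load-all []      A _  _  = refl
    load-all (z ∷ u) A ≤w c! = begin
      run s (s z A) u             ≡⟨ cong (λ c → run s c u) (step-load z∉A (s-step z A)) ⟩
      run s (z ∷ take w A) u      ≡⟨ cong (λ c → run s (z ∷ c) u)
                                       (take-all w A (≤-trans (m≤n+m (length A) (length u)) (s≤s⁻¹ ≤w))) ⟩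
      run s (z ∷ A) u             ≡⟨ load-all u (z ∷ A) (≤-trans (≤-reflexive (+-suc (length u) (length A))) ≤w) z! ⟩
      reverse u ++ z ∷ A          ≡⟨ ++-assoc (reverse u) [ z ] A ⟨
      (reverse u ∷ʳ z) ++ A       ≡⟨ cong (_++ A) (unfold-reverse z u) ⟨
      reverse (z ∷ u) ++ A        ∎
      where
      open ≡-Reasoning
      z! : Unique (z ∷ A ++ u)
      z! = Unique-↭ (↭.shift z A u) c!
      z∉A : z ∉ A
      z∉A = Unique⇒∉ z! ∘ ∈-++⁺ˡ

    step-cycle : ∀ c → length c ≡ suc w → Unique (c ∷ʳ z) →
      miss z (take (suc w) (c ∷ʳ z)) ≡ 1 × s z (take (suc w) (c ∷ʳ z)) ≡ take (suc w) (z ∷ c)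
    step-cycle {z} c len c! rewrite take-length-++ c {[ z ]} len =
      let z∉c = Unique⇒∉ (Unique-∷ʳ c!) in miss-∉ z∉c , step-load z∉c (s-step z c)

    -- The list has `suc (suc w)` pages, and the cache is all but the last of them. The last is
    -- requested next; loading it evicts the page before it, so the list rotates by one place and
    -- the situation recurs.
    cycle : ∀ A u → length u + length A ≡ suc (suc w) → Unique (A ++ reverse u) →
      let c = take (suc w) (A ++ reverse u) in
      run s c u ≡ take (suc w) (reverse u ++ A) × faults s c u ≡ length u
    cycle A [] _ _ rewrite ++-identityʳ A = refl , refl
    cycle A (z ∷ u) len c!
      rewrite unfold-reverse z u | sym (++-assoc A (reverse u) [ z ]) | ++-assoc (reverse u) [ z ] A
      with len′ ← trans (length-++ A) (trans (+-comm (length A) _)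
             (trans (cong (_+ length A) (length-reverse u)) (suc-injective len)))
      with miss≡ , s≡ ← step-cycle (A ++ reverse u) len′ c!
      rewrite miss≡ | s≡
      with run≡ , faults≡ ← cycle (z ∷ A) u (trans (+-suc (length u) (length A)) len) (Unique-∷ʳ c!)
      = run≡ , cong suc faults≡

  Distinct : (ℕ → Page) → Set
  Distinct f = ∀ {i j} → f i ≡ f j → i ≡ j

  -- Shifting `f` between rounds supplies one new page per round and retires `f 0`.
  rounds : ((ℕ → Page) → Pages) → (ℕ → Page) → ℕ → Pages
  rounds r f zero    = []
  rounds r f (suc j) = r f ++ rounds r (f ∘ suc) j

  applyUpTo-! : ∀ {f} → Distinct f → ∀ n → Unique (applyUpTo f n)
  applyUpTo-! f! n = Unique.applyUpTo⁺₁ _ n λ i<j _ fi≡fj → <⇒≢ i<j (f! fi≡fj)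

  take-applyUpTo : ∀ (f : ℕ → Page) n → take n (applyUpTo f (suc n)) ≡ applyUpTo f n
  take-applyUpTo f zero    = refl
  take-applyUpTo f (suc n) = cong (f 0 ∷_) (take-applyUpTo (f ∘ suc) n)

  rounds-run : ∀ {s} {r state : (ℕ → Page) → Pages} n →
    (∀ {f} → Distinct f → run s (state f) (r f) ≡ state (f ∘ suc) × faults s (state f) (r f) ≡ n) →
    ∀ {f} → Distinct f → ∀ j → faults s (state f) (rounds r f j) ≡ j * n
  rounds-run n round f! zero = refl
  rounds-run {s} {r} {state} n round {f} f! (suc j) with round f!
  ... | run≡ , faults≡ = begin
    faults s (state f) (r f ++ rounds r (f ∘ suc) j)
      ≡⟨ faults-++ s (r f) _ ⟩
    faults s (state f) (r f) + faults s (run s (state f) (r f)) (rounds r (f ∘ suc) j)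
      ≡⟨ cong₂ (λ m c → m + faults s c (rounds r (f ∘ suc) j)) faults≡ run≡ ⟩
    n + faults s (state (f ∘ suc)) (rounds r (f ∘ suc) j)
      ≡⟨ cong (λ m → n + m) (rounds-run {state = state} n round (λ eq → suc-injective (f! eq)) j) ⟩
    n + j * n ∎
    where open ≡-Reasoning

  length-rounds : ∀ {r} n → (∀ f → length (r f) ≡ n) → ∀ f j → length (rounds r f j) ≡ j * n
  length-rounds n len f zero    = refl
  length-rounds {r} n len f (suc j) =
    trans (length-++ (r f)) (cong₂ _+_ (len f) (length-rounds n len (f ∘ suc) j))

  module _ (w : ℕ) where

    window : (ℕ → Page) → Pages
    window f = applyUpTo f (suc w)

    -- The new page is `f (suc w)`, and both rounds end with `f (suc w)`, `f w`, down to `f 1`. In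
    -- `maxRound` these follow hits on `f w` down to `f 1`.
    maxRound minRound : (ℕ → Page) → Pages
    maxRound f = reverse (applyUpTo (f ∘ suc) w) ++ reverse (window (f ∘ suc))
    minRound f = reverse (window (f ∘ suc))

    reverse-window : ∀ f → reverse (window f) ≡ f w ∷ reverse (applyUpTo f w)
    reverse-window f = trans (cong reverse (sym (applyUpTo-∷ʳ f w))) (reverse-++ (applyUpTo f w) [ f w ])

    length-minRound : ∀ f → length (minRound f) ≡ suc w
    length-minRound f = trans (length-reverse (window (f ∘ suc))) (length-applyUpTo (f ∘ suc) (suc w))

    length-maxRound : ∀ f → length (maxRound f) ≡ w + suc w
    length-maxRound f = trans (length-++ (reverse (applyUpTo (f ∘ suc) w)))
      (cong₂ _+_ (trans (length-reverse (applyUpTo (f ∘ suc) w)) (length-applyUpTo (f ∘ suc) w)) (length-minRound f))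

    -- Covers FIFO in the second half of `maxRound` and LRU in the whole of `minRound`.
    cycle-round : ∀ {s} → Demand w s → ∀ {f} → Distinct f →
      run s (window f) (minRound f) ≡ window (f ∘ suc) × faults s (window f) (minRound f) ≡ suc w
    cycle-round {s} s-step {f} f!
      with cycle s-step [ f 0 ] (minRound f)
             (trans (+-comm (length (minRound f)) 1) (cong suc (length-minRound f)))
             (subst (λ u → Unique (f 0 ∷ u)) (sym (reverse-involutive (window (f ∘ suc))))
               (applyUpTo-! f! (suc (suc w))))
    ... | run≡ , faults≡
      rewrite reverse-involutive (window (f ∘ suc)) | take-applyUpTo (f ∘ suc) w
            | take-length-++ (applyUpTo (f ∘ suc) (suc w)) {[ f 0 ]} (length-applyUpTo (f ∘ suc) (suc w))
      = run≡ , trans faults≡ (length-minRound f)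

    private
      ∉-applyUpTo : ∀ {f} → Distinct f → f w ∉ applyUpTo f w
      ∉-applyUpTo {f} f! = Unique⇒∉ (Unique-∷ʳ
        (subst Unique (sym (applyUpTo-∷ʳ f w)) (applyUpTo-! f! (suc w))))

    fifo-maxRound : ∀ {f} → Distinct f →
      run (fifo w) (window f) (maxRound f) ≡ window (f ∘ suc) ×
      faults (fifo w) (window f) (maxRound f) ≡ suc w
    fifo-maxRound {f} f!
      with fifo-hits-run w {window f} (reverse (applyUpTo (f ∘ suc) w)) (λ x∈ → there (Any.reverse⁻ x∈))
    ... | run≡ , faults≡
      rewrite run-++ {window f} (fifo w) (reverse (applyUpTo (f ∘ suc) w)) (reverse (window (f ∘ suc)))
            | faults-++ {window f} (fifo w) (reverse (applyUpTo (f ∘ suc) w)) (reverse (window (f ∘ suc)))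
            | faults≡ | run≡ = cycle-round (fifo-step w) f!

    lru-maxRound : ∀ {f} → Distinct f →
      run (lru w) (window f) (maxRound f) ≡ window (f ∘ suc) ×
      faults (lru w) (window f) (maxRound f) ≡ 1
    lru-maxRound {f} f! = run≡ , faults≡
      where
      open ≡-Reasoning
      l = applyUpTo (f ∘ suc) w
      new = f (suc w)
      -- Used twice. With `f 0` in front, the hits send it to the back, where the new page evicts
      -- it; with the new page in front, they send that page to the back and restore the shape of a
      -- window.
      l-rotates : ∀ y → Unique (y ∷ l) →
        run (lru w) (y ∷ l) (reverse l) ≡ l ∷ʳ y × faults (lru w) (y ∷ l) (reverse l) ≡ 0
      l-rotates y y! = subst
        (λ u → Unique (y ∷ u) →
          run (lru w) (y ∷ u) (reverse l) ≡ u ∷ʳ y × faults (lru w) (y ∷ u) (reverse l) ≡ 0)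
        (reverse-involutive l) (lru-hits-rotate w [ y ] (reverse l)) y!
      !f∘suc : Distinct (f ∘ suc)
      !f∘suc eq = suc-injective (f! eq)
      new∉l = ∉-applyUpTo !f∘suc
      first = l-rotates (f 0) (applyUpTo-! f! (suc w))
      last = l-rotates new (Unique-∷ new∉l (applyUpTo-! !f∘suc w))
      new∉ : new ∉ l ∷ʳ f 0
      new∉ new∈ with ∈-++⁻ l new∈
      ... | inj₁ new∈l = new∉l new∈l
      ... | inj₂ (here new≡f0) with () ← f! new≡f0
      load≡ : lru w new (l ∷ʳ f 0) ≡ new ∷ l
      load≡ = trans (step-load new∉ (lru-step w new (l ∷ʳ f 0)))
                    (cong (new ∷_) (take-length-++ l (length-applyUpTo (f ∘ suc) w)))
      run≡ : run (lru w) (window f) (maxRound f) ≡ window (f ∘ suc)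
      run≡ = begin
        run (lru w) (window f) (maxRound f)
          ≡⟨ run-++ (lru w) (reverse l) (reverse (window (f ∘ suc))) ⟩
        run (lru w) (run (lru w) (f 0 ∷ l) (reverse l)) (reverse (window (f ∘ suc)))
          ≡⟨ cong₂ (run (lru w)) (proj₁ first) (reverse-window (f ∘ suc)) ⟩
        run (lru w) (lru w new (l ∷ʳ f 0)) (reverse l)
          ≡⟨ cong (λ c → run (lru w) c (reverse l)) load≡ ⟩
        run (lru w) (new ∷ l) (reverse l)
          ≡⟨ proj₁ last ⟩
        l ∷ʳ new
          ≡⟨ applyUpTo-∷ʳ (f ∘ suc) w ⟩
        window (f ∘ suc) ∎
      faults≡ : faults (lru w) (window f) (maxRound f) ≡ 1
      faults≡ = begin
        faults (lru w) (window f) (maxRound f)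
          ≡⟨ faults-++ (lru w) (reverse l) (reverse (window (f ∘ suc))) ⟩
        faults (lru w) (f 0 ∷ l) (reverse l) +
        faults (lru w) (run (lru w) (f 0 ∷ l) (reverse l)) (reverse (window (f ∘ suc)))
          ≡⟨ cong₂ _+_ (proj₂ first) (cong₂ (faults (lru w)) (proj₁ first) (reverse-window (f ∘ suc))) ⟩
        miss new (l ∷ʳ f 0) + faults (lru w) (lru w new (l ∷ʳ f 0)) (reverse l)
          ≡⟨ cong₂ _+_ (miss-∉ new∉) (cong (λ c → faults (lru w) c (reverse l)) load≡) ⟩
        1 + faults (lru w) (new ∷ l) (reverse l)
          ≡⟨ cong suc (proj₂ last) ⟩
        1 ∎

    fifo-minRound : ∀ {f} → Distinct f →
      run (fifo w) (reverse (window f)) (minRound f) ≡ reverse (window (f ∘ suc)) ×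
      faults (fifo w) (reverse (window f)) (minRound f) ≡ 1
    fifo-minRound {f} f! = run≡ , faults≡
      where
      open ≡-Reasoning
      l = applyUpTo (f ∘ suc) w
      new = f (suc w)
      !f∘suc : Distinct (f ∘ suc)
      !f∘suc eq = suc-injective (f! eq)
      new∉ : new ∉ reverse (window f)
      new∉ new∈ with Any.reverse⁻ {xs = window f} new∈
      ... | here new≡f0 with () ← f! new≡f0
      new∉ new∈ | there new∈l = ∉-applyUpTo !f∘suc new∈l
      load≡ : fifo w new (reverse (window f)) ≡ new ∷ reverse l
      load≡ = trans (step-load new∉ (fifo-step w new (reverse (window f))))
        (cong (new ∷_) (trans (cong (take w) (unfold-reverse (f 0) l))
          (take-length-++ (reverse l) (trans (length-reverse l) (length-applyUpTo (f ∘ suc) w)))))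
      hits = fifo-hits-run w {new ∷ reverse l} (reverse l) there
      run≡ : run (fifo w) (reverse (window f)) (minRound f) ≡ reverse (window (f ∘ suc))
      run≡ = begin
        run (fifo w) (reverse (window f)) (minRound f)
          ≡⟨ cong (run (fifo w) (reverse (window f))) (reverse-window (f ∘ suc)) ⟩
        run (fifo w) (fifo w new (reverse (window f))) (reverse l)
          ≡⟨ cong (λ c → run (fifo w) c (reverse l)) load≡ ⟩
        run (fifo w) (new ∷ reverse l) (reverse l)
          ≡⟨ proj₁ hits ⟩
        new ∷ reverse l
          ≡⟨ reverse-window (f ∘ suc) ⟨
        reverse (window (f ∘ suc)) ∎
      faults≡ : faults (fifo w) (reverse (window f)) (minRound f) ≡ 1
      faults≡ = begin
        faults (fifo w) (reverse (window f)) (minRound f)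
          ≡⟨ cong (faults (fifo w) (reverse (window f))) (reverse-window (f ∘ suc)) ⟩
        miss new (reverse (window f)) + faults (fifo w) (fifo w new (reverse (window f))) (reverse l)
          ≡⟨ cong₂ _+_ (miss-∉ new∉) (cong (λ c → faults (fifo w) c (reverse l)) load≡) ⟩
        1 + faults (fifo w) (new ∷ reverse l) (reverse l)
          ≡⟨ cong suc (proj₂ hits) ⟩
        1 ∎

    -- Loading `window f` backwards puts both caches in the order of `window f`. Loading it forwards
    -- puts both in the reverse order, after which a pass of hits reverses the queue of LRU and
    -- leaves that of FIFO alone.
    maxPrefix minPrefix : (ℕ → Page) → Pages
    maxPrefix f = reverse (window f)
    minPrefix f = window f ++ reverse (window f)

    maxPrefix-run : ∀ {s} → Demand w s → ∀ {f} → Distinct f → run s [] (maxPrefix f) ≡ window f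
    maxPrefix-run {s} s-step {f} f! = begin
      run s [] (reverse (window f))       ≡⟨ load-all s-step (reverse (window f)) [] (≤-reflexive len) window! ⟩
      reverse (reverse (window f)) ++ []  ≡⟨ ++-identityʳ _ ⟩
      reverse (reverse (window f))        ≡⟨ reverse-involutive (window f) ⟩
      window f                            ∎
      where
      open ≡-Reasoning
      len : length (reverse (window f)) + 0 ≡ suc w
      len = trans (+-identityʳ _) (trans (length-reverse (window f)) (length-applyUpTo f (suc w)))
      window! : Unique (reverse (window f))
      window! = Unique-↭ (↭-sym (↭.↭-reverse (window f))) (applyUpTo-! f! (suc w))

    window-run : ∀ {s} → Demand w s → ∀ {f} → Distinct f → run s [] (window f) ≡ reverse (window f)
    window-run s-step {f} f! = trans
      (load-all s-step (window f) [] (≤-reflexive (trans (+-identityʳ _) (length-applyUpTo f (suc w))))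
        (applyUpTo-! f! (suc w)))
      (++-identityʳ _)

    minPrefix-run : ∀ {s} → Demand w s → ∀ {f} → Distinct f →
      run s [] (minPrefix f) ≡ run s (reverse (window f)) (reverse (window f))
    minPrefix-run {s} s-step {f} f! = trans (run-++ s (window f) (reverse (window f)))
      (cong (λ c → run s c (reverse (window f))) (window-run s-step f!))

    fifo-minPrefix : ∀ {f} → Distinct f → run (fifo w) [] (minPrefix f) ≡ reverse (window f)
    fifo-minPrefix {f} f! = trans (minPrefix-run (fifo-step w) f!)
      (proj₁ (fifo-hits-run w (reverse (window f)) λ x∈ → x∈))

    lru-minPrefix : ∀ {f} → Distinct f → run (lru w) [] (minPrefix f) ≡ window f
    lru-minPrefix {f} f! = begin
      run (lru w) [] (minPrefix f)                           ≡⟨ minPrefix-run (lru-step w) f! ⟩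
      run (lru w) (reverse (window f)) (reverse (window f))  ≡⟨ lru-hits-reverse w [] (reverse (window f)) window! ⟩
      reverse (reverse (window f)) ++ []                     ≡⟨ ++-identityʳ _ ⟩
      reverse (reverse (window f))                           ≡⟨ reverse-involutive (window f) ⟩
      window f                                               ∎
      where
      open ≡-Reasoning
      window! : Unique (reverse (window f))
      window! = Unique-↭ (↭-sym (↭.↭-reverse (window f))) (applyUpTo-! f! (suc w))

-- Limits inferior and superior from linear bounds.

toℚᵘ-/ : ∀ i n → toℚᵘ (i ℚ./ suc n) ℚᵘ.≃ mkℚᵘ i n
toℚᵘ-/ i n = ℚ.toℚᵘ-fromℚᵘ (mkℚᵘ i n)

*-distribˡ-⊖ : ∀ b m n → + b ℤ.* (m ℤ.⊖ n) ≡ + (b ℕ.* m) ℤ.- + (b ℕ.* n)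
*-distribˡ-⊖ b m n = begin
  + b ℤ.* (m ℤ.⊖ n)                   ≡⟨ cong (+ b ℤ.*_) (ℤ.m-n≡m⊖n m n) ⟨
  + b ℤ.* (+ m ℤ.- + n)               ≡⟨ lemma (+ b) (+ m) (+ n) ⟩
  + b ℤ.* + m ℤ.- + b ℤ.* + n         ≡⟨ cong₂ ℤ._-_ (sym (ℤ.pos-* b m)) (sym (ℤ.pos-* b n)) ⟩
  + (b ℕ.* m) ℤ.- + (b ℕ.* n)         ∎
  where
  open ≡-Reasoning
  lemma : ∀ x y z → x ℤ.* (y ℤ.- z) ≡ x ℤ.* y ℤ.- x ℤ.* z
  lemma = ℤ.solve-∀

-- Passes from an inequality of natural numbers, arranged without subtraction, to a bound on the
-- signed difference of faults.
≤⇒⊖-≤ : ∀ b m n {x y} → b ℕ.* m ℕ.+ x ℕ.≤ b ℕ.* n ℕ.+ y → + b ℤ.* (m ℤ.⊖ n) ℤ.≤ + y ℤ.- + x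
≤⇒⊖-≤ b m n {x} {y} le = begin
  + b ℤ.* (m ℤ.⊖ n)                                      ≡⟨ *-distribˡ-⊖ b m n ⟩
  + (b ℕ.* m) ℤ.- + (b ℕ.* n)                            ≡⟨ lemma (+ (b ℕ.* m)) (+ (b ℕ.* n)) (+ x) ⟩
  + (b ℕ.* m) ℤ.+ + x ℤ.+ (ℤ.- + (b ℕ.* n) ℤ.- + x)      ≤⟨ ℤ.+-monoˡ-≤ (ℤ.- + (b ℕ.* n) ℤ.- + x) (ℤ.+≤+ le) ⟩
  + (b ℕ.* n) ℤ.+ + y ℤ.+ (ℤ.- + (b ℕ.* n) ℤ.- + x)      ≡⟨ lemma′ (+ (b ℕ.* n)) (+ y) (+ x) ⟩
  + y ℤ.- + x                                            ∎
  where
  open ℤ.≤-Reasoning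
  lemma : ∀ p q r → p ℤ.- q ≡ p ℤ.+ r ℤ.+ (ℤ.- q ℤ.- r)
  lemma = ℤ.solve-∀
  lemma′ : ∀ q s r → q ℤ.+ s ℤ.+ (ℤ.- q ℤ.- r) ≡ s ℤ.- r
  lemma′ = ℤ.solve-∀

≤⇒≤-⊖ : ∀ b m n {x y} → b ℕ.* m ℕ.+ x ℕ.≤ b ℕ.* n ℕ.+ y → + x ℤ.- + y ℤ.≤ + b ℤ.* (n ℤ.⊖ m)
≤⇒≤-⊖ b m n {x} {y} le = begin
  + x ℤ.- + y                                            ≡⟨ lemma′ (+ (b ℕ.* m)) (+ x) (+ y) ⟨
  + (b ℕ.* m) ℤ.+ + x ℤ.+ (ℤ.- + (b ℕ.* m) ℤ.- + y)      ≤⟨ ℤ.+-monoˡ-≤ (ℤ.- + (b ℕ.* m) ℤ.- + y) (ℤ.+≤+ le) ⟩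
  + (b ℕ.* n) ℤ.+ + y ℤ.+ (ℤ.- + (b ℕ.* m) ℤ.- + y)      ≡⟨ lemma (+ (b ℕ.* n)) (+ (b ℕ.* m)) (+ y) ⟨
  + (b ℕ.* n) ℤ.- + (b ℕ.* m)                            ≡⟨ *-distribˡ-⊖ b n m ⟨
  + b ℤ.* (n ℤ.⊖ m)                                      ∎
  where
  open ℤ.≤-Reasoning
  lemma : ∀ p q r → p ℤ.- q ≡ p ℤ.+ r ℤ.+ (ℤ.- q ℤ.- r)
  lemma = ℤ.solve-∀
  lemma′ : ∀ q s r → q ℤ.+ s ℤ.+ (ℤ.- q ℤ.- r) ≡ s ℤ.- r
  lemma′ = ℤ.solve-∀

module _ (a : ℤ) (b : ℕ) .{{_ : NonZero b}} (C : ℕ) where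

  -- The bounds `f / n ≥ a / b - C / (b n)` and `f / n ≤ a / b + C / (b n)`, cleared of
  -- denominators.
  Above Below : ℕ → ℤ → Set
  Above n f = a ℤ.* + n ℤ.- + C ℤ.≤ + b ℤ.* f
  Below n f = + b ℤ.* f ℤ.≤ a ℤ.* + n ℤ.+ + C

  threshold : ℚ → ℕ
  threshold ε = suc (C ℕ.* ℚ.↧ₙ ε)

private
  pos-*₃ : ∀ x y z → + (x ℕ.* y ℕ.* z) ≡ + x ℤ.* + y ℤ.* + z
  pos-*₃ x y z = trans (ℤ.pos-* (x ℕ.* y) z) (cong (ℤ._* + z) (ℤ.pos-* x y))

  -- C d < n makes the error C / (b n) smaller than ε = p / d.

  error< : ∀ C d p b n → C ℕ.* d ℕ.< n → + C ℤ.* + d ℤ.< + suc p ℤ.* + suc b ℤ.* + n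
  error< C d p b n lt = begin-strict
    + C ℤ.* + d                        ≡⟨ ℤ.pos-* C d ⟨
    + (C ℕ.* d)                        <⟨ ℤ.+<+ (ℕ.<-≤-trans lt (ℕ.m≤n*m n (suc p ℕ.* suc b))) ⟩
    + (suc p ℕ.* suc b ℕ.* n)          ≡⟨ pos-*₃ (suc p) (suc b) n ⟩
    + suc p ℤ.* + suc b ℤ.* + n        ∎
    where open ℤ.≤-Reasoning

below-limit : ∀ a b C {n f ε} .{{_ : NonZero b}} .{{_ : NonZero n}} → 0ℚ ℚ.< ε →
  Below a b C n f → threshold a b C ε ℕ.≤ n → f ℚ./ n ℚ.< a ℚ./ b ℚ.+ ε
below-limit _ _ _ {ε = mkℚ (+ 0) d-1 _} (ℚ.*<* (ℤ.+<+ ()))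
below-limit _ _ _ {ε = mkℚ -[1+ _ ] d-1 _} (ℚ.*<* ())
below-limit a b@(suc b-1) C {n@(suc n-1)} {f} {ε@(mkℚ (+ suc p) d-1 _)} _ below N≤n = ℚ.toℚᵘ-cancel-<
  (ℚᵘ.<-respˡ-≃ (ℚᵘ.≃-sym (toℚᵘ-/ f n-1)) (ℚᵘ.<-respʳ-≃
    (ℚᵘ.≃-sym (ℚᵘ.≃-trans (ℚ.toℚᵘ-homo-+ (a ℚ./ b) ε) (ℚᵘ.+-congˡ (toℚᵘ ε) (toℚᵘ-/ a b-1))))
    (ℚᵘ.*<* cross)))
  where
  open ℤ.≤-Reasoning
  d = suc d-1
  eq₁ : ∀ f b d → f ℤ.* (b ℤ.* d) ≡ b ℤ.* f ℤ.* d
  eq₁ = ℤ.solve-∀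
  eq₂ : ∀ a n C d → (a ℤ.* n ℤ.+ C) ℤ.* d ≡ a ℤ.* n ℤ.* d ℤ.+ C ℤ.* d
  eq₂ = ℤ.solve-∀
  eq₃ : ∀ a n d p b → a ℤ.* n ℤ.* d ℤ.+ p ℤ.* b ℤ.* n ≡ (a ℤ.* d ℤ.+ p ℤ.* b) ℤ.* n
  eq₃ = ℤ.solve-∀
  cross : f ℤ.* (+ b ℤ.* + d) ℤ.< (a ℤ.* + d ℤ.+ + suc p ℤ.* + b) ℤ.* + n
  cross = begin-strict
    f ℤ.* (+ b ℤ.* + d)                             ≡⟨ eq₁ f (+ b) (+ d) ⟩
    + b ℤ.* f ℤ.* + d                               ≤⟨ ℤ.*-monoʳ-≤-nonNeg (+ d) below ⟩
    (a ℤ.* + n ℤ.+ + C) ℤ.* + d                     ≡⟨ eq₂ a (+ n) (+ C) (+ d) ⟩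
    a ℤ.* + n ℤ.* + d ℤ.+ + C ℤ.* + d               <⟨ ℤ.+-monoʳ-< (a ℤ.* + n ℤ.* + d) (error< C d p b-1 n N≤n) ⟩
    a ℤ.* + n ℤ.* + d ℤ.+ + suc p ℤ.* + b ℤ.* + n   ≡⟨ eq₃ a (+ n) (+ d) (+ suc p) (+ b) ⟩
    (a ℤ.* + d ℤ.+ + suc p ℤ.* + b) ℤ.* + n         ∎

above-limit : ∀ a b C {n f ε} .{{_ : NonZero b}} .{{_ : NonZero n}} → 0ℚ ℚ.< ε →
  Above a b C n f → threshold a b C ε ℕ.≤ n → a ℚ./ b ℚ.- ε ℚ.< f ℚ./ n
above-limit _ _ _ {ε = mkℚ (+ 0) d-1 _} (ℚ.*<* (ℤ.+<+ ()))
above-limit _ _ _ {ε = mkℚ -[1+ _ ] d-1 _} (ℚ.*<* ())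
above-limit a b@(suc b-1) C {n@(suc n-1)} {f} {ε@(mkℚ (+ suc p) d-1 _)} _ above N≤n = ℚ.toℚᵘ-cancel-<
  (ℚᵘ.<-respʳ-≃ (ℚᵘ.≃-sym (toℚᵘ-/ f n-1)) (ℚᵘ.<-respˡ-≃
    (ℚᵘ.≃-sym (ℚᵘ.≃-trans (ℚ.toℚᵘ-homo-+ (a ℚ./ b) (ℚ.- ε)) (ℚᵘ.+-congˡ (toℚᵘ (ℚ.- ε)) (toℚᵘ-/ a b-1))))
    (ℚᵘ.*<* cross)))
  where
  open ℤ.≤-Reasoning
  d = suc d-1
  eq₁ : ∀ f b d → b ℤ.* f ℤ.* d ≡ f ℤ.* (b ℤ.* d)
  eq₁ = ℤ.solve-∀
  eq₂ : ∀ a n C d → a ℤ.* n ℤ.* d ℤ.- C ℤ.* d ≡ (a ℤ.* n ℤ.- C) ℤ.* d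
  eq₂ = ℤ.solve-∀
  eq₃ : ∀ a n d p b → (a ℤ.* d ℤ.+ ℤ.- p ℤ.* b) ℤ.* n ≡ a ℤ.* n ℤ.* d ℤ.- p ℤ.* b ℤ.* n
  eq₃ = ℤ.solve-∀
  cross : (a ℤ.* + d ℤ.+ ℤ.- + suc p ℤ.* + b) ℤ.* + n ℤ.< f ℤ.* (+ b ℤ.* + d)
  cross = begin-strict
    (a ℤ.* + d ℤ.+ ℤ.- + suc p ℤ.* + b) ℤ.* + n     ≡⟨ eq₃ a (+ n) (+ d) (+ suc p) (+ b) ⟩
    a ℤ.* + n ℤ.* + d ℤ.- + suc p ℤ.* + b ℤ.* + n   <⟨ ℤ.+-monoʳ-< (a ℤ.* + n ℤ.* + d) (ℤ.neg-mono-< (error< C d p b-1 n N≤n)) ⟩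
    a ℤ.* + n ℤ.* + d ℤ.- + C ℤ.* + d               ≡⟨ eq₂ a (+ n) (+ C) (+ d) ⟩
    (a ℤ.* + n ℤ.- + C) ℤ.* + d                     ≤⟨ ℤ.*-monoʳ-≤-nonNeg (+ d) above ⟩
    + b ℤ.* f ℤ.* + d                               ≡⟨ eq₁ f (+ b) (+ d) ⟩
    f ℤ.* (+ b ℤ.* + d)                             ∎

module _ (a : ℤ) (b C : ℕ) .{{_ : NonZero b}} {f : ℕ → ℤ} where

  Frequently : (ℕ → ℤ → Set) → Set
  Frequently P = ∀ N → ∃[ n ] (N ℕ.≤ n × P n (f n))

  private
    past : ∀ P → Frequently P → ∀ N → Σ[ n ∈ ℕ ] Σ[ n≢0 ∈ NonZero n ] (N ℕ.≤ n × P n (f n))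
    -- Asking for `suc N` makes `n` nonzero, so that one can divide by it.
    past P freq N with freq (suc N)
    ... | n@(suc _) , N<n , Pn = n , _ , ℕ.<⇒≤ N<n , Pn

  liminf : (∀ n → Above a b C n (f n)) → Frequently (Below a b C) → Liminf (perRequest f) (a ℚ./ b)
  liminf above below ε 0<ε =
    (threshold a b C ε , λ n N≤n → above-limit a b C 0<ε (above n) N≤n) ,
    λ N → let n , n≢0 , N≤n , bn = past (Below a b C) below (threshold a b C ε ℕ.+ N) in
      n , n≢0 , ℕ.≤-trans (ℕ.m≤n+m N _) N≤n ,
      below-limit a b C {{_}} {{n≢0}} 0<ε bn (ℕ.≤-trans (ℕ.m≤m+n _ N) N≤n)

  limsup : (∀ n → Below a b C n (f n)) → Frequently (Above a b C) → Limsup (perRequest f) (a ℚ./ b)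
  limsup below above ε 0<ε =
    (threshold a b C ε , λ n N≤n → below-limit a b C 0<ε (below n) N≤n) ,
    λ N → let n , n≢0 , N≤n , an = past (Above a b C) above (threshold a b C ε ℕ.+ N) in
      n , n≢0 , ℕ.≤-trans (ℕ.m≤n+m N _) N≤n ,
      above-limit a b C {{_}} {{n≢0}} 0<ε an (ℕ.≤-trans (ℕ.m≤m+n _ N) N≤n)

-- Time-stamped caches behave like queues.

module Simulation {Page : Set} (_≟_ : DecidableEquality Page) where

  open Queues _≟_
  open Paging _≟_
  open import Data.List.Membership.DecPropositional _≟_ using (_∈?_)

  private variable
    p : Page
    c s : Cache
    t w : ℕ
    stamp : Entry → ℕ

  AllPairs-∷ʳ⁻ : ∀ {R : Entry → Entry → Set} s {x z} → AllPairs R (s ∷ʳ z) → x ∈ s → R x z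
  AllPairs-∷ʳ⁻ (_ ∷ s) (Rx ∷ _)  (here refl) = All.lookup Rx (∈-++⁺ʳ s (here refl))
  AllPairs-∷ʳ⁻ (_ ∷ s) (_ ∷ Rs) (there x∈) = AllPairs-∷ʳ⁻ s Rs x∈

  -- The queue `s` is the cache sorted by time stamp, largest first. It is related to `c` by a
  -- permutation only, because touching an entry leaves it in its place in `c`.
  record Lists (stamp : Entry → ℕ) (t : ℕ) (c s : Cache) : Set where
    field
      ordering   : c ↭ s
      decreasing : AllPairs (λ e e′ → stamp e′ < stamp e) s
      past       : All (λ e → stamp e < t) s

  open Lists

  dropPage : Page → Cache → Cache
  dropPage p = filter (λ x → ¬? (page x ≟ p))

  dropPage-∉ : p ∉ map page s → dropPage p s ≡ s
  dropPage-∉ p∉ = filter-all _ (All.tabulate λ { e∈s refl → p∉ (∈-map⁺ page e∈s) })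

  dropPage-self : ∀ e → dropPage (page e) (e ∷ s) ≡ dropPage (page e) s
  dropPage-self e with page e ≟ page e
  ... | yes _  = refl
  ... | no e≢e = contradiction refl e≢e

  map-dropPage : ∀ p s → map page (dropPage p s) ≡ remove p (map page s)
  map-dropPage p []      = refl
  map-dropPage p (e ∷ s) with page e ≟ p
  ... | yes _ = map-dropPage p s
  ... | no _  = cong (page e ∷_) (map-dropPage p s)

  dropLast : ∀ s {z} → Unique (map page (s ∷ʳ z)) → dropPage (page z) (s ∷ʳ z) ≡ s
  dropLast [] {z} _ = dropPage-self {[]} z
  dropLast (e ∷ s) {z} (e∉ ∷ s!) with page e ≟ page z
  ... | yes e≡z = contradiction e≡z (All.lookup e∉ (∈-map⁺ page (∈-++⁺ʳ s (here refl))))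
  ... | no _    = cong (e ∷_) (dropLast s s!)

  -- The victim is an entry of the queue, and any entry ahead of `z` has a strictly larger stamp
  -- than `z`, so it is not minimal.
  victim-last : ∀ e es s {z} → e ∷ es ↭ s ∷ʳ z →
    AllPairs (λ e e′ → stamp e′ < stamp e) (s ∷ʳ z) → ℕ.argmin stamp e es ≡ z
  victim-last {stamp} e es s {z} c↭ dec with ∈-++⁻ s (↭.∈-resp-↭ c↭ victim∈)
    where
    victim∈ : ℕ.argmin stamp e es ∈ e ∷ es
    victim∈ with ℕ.argmin-sel stamp e es
    ... | inj₁ eq = here eq
    ... | inj₂ ∈es = there ∈es
  ... | inj₂ (here eq) = eq
  ... | inj₁ ∈s = contradiction (AllPairs-∷ʳ⁻ s dec ∈s) (≤⇒≯ (All.lookup minimal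
      (↭.∈-resp-↭ (↭-sym c↭) (∈-++⁺ʳ s (here refl)))))
    where
    minimal : All (λ x → stamp (ℕ.argmin stamp e es) ≤ stamp x) (e ∷ es)
    minimal = ℕ.f[argmin]≤f[⊤] {f = stamp} e es ∷ ℕ.f[argmin]≤f[xs] e es

  evict-↭ : ∀ c s → Lists stamp t c s → Unique (map page s) → length s ≡ suc w → evict stamp c ↭ take w s
  evict-↭ {stamp} {w = w} c s r s! len with initLast s
  evict-↭ []       _ r s! () | []
  evict-↭ (_ ∷ _)  _ r s! () | []
  evict-↭ []       _ r s! len | s ∷ʳ′ z with () ← trans (↭.↭-length (ordering r)) len
  evict-↭ {stamp} {w = w} (e ∷ es) _ r s! len | s ∷ʳ′ z
    rewrite victim-last {stamp} e es s (ordering r) (decreasing r) =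
    ↭-trans (↭.filter-↭ _ (ordering r)) (↭-reflexive (trans (dropLast s s!) (sym take≡)))
    where
    len′ : length s ≡ w
    len′ = suc-injective (trans (+-comm 1 (length s)) (trans (sym (length-++ s)) len))
    take≡ : take w (s ∷ʳ z) ≡ s
    take≡ = take-length-++ s len′

  makeRoom-↭ : ∀ w → Lists stamp t c s → Unique (map page s) → length s ≤ suc w →
               makeRoom stamp (suc w) c ↭ take w s
  makeRoom-↭ {stamp} {c = c} {s} w r s! s≤ with <-cmp (length s) (suc w)
  ... | tri> _ _ s> = contradiction s≤ (<⇒≱ s>)
  ... | tri< s< _ _
    rewrite dec-false (suc w ≤? length c) (λ w< → <⇒≱ s< (≤-trans w< (≤-reflexive (↭.↭-length (ordering r)))))
          | take-all w s (s≤s⁻¹ s<) = ordering r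
  ... | tri≈ _ len _
    rewrite dec-true (suc w ≤? length c) (≤-reflexive (sym (trans (↭.↭-length (ordering r)) len))) =
    evict-↭ c s r s! len

  load-Lists : ∀ w → (∀ {p t} → stamp (entry p t t) ≡ t) → Lists stamp t c s →
    Unique (map page s) → length s ≤ suc w →
    Lists stamp (suc t) (entry p t t ∷ makeRoom stamp (suc w) c) (entry p t t ∷ take w s)
  load-Lists {stamp} w stamped r s! s≤ = record
    { ordering   = ↭.prep _ (makeRoom-↭ w r s! s≤)
    ; decreasing = All.map (subst (_ <_) (sym stamped)) (All.take⁺ w (past r)) ∷ AllPairs.take⁺ w (decreasing r)
    ; past       = ≤-reflexive (cong suc stamped) ∷ All.map m<n⇒m<1+n (All.take⁺ w (past r))
    }

  -- The part of the simulation that depends on the policy: `h` is the effect of a hit on the queue.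
  -- Faults are treated uniformly by `load-Lists`.
  Hits : (Entry → ℕ) → (Page → Pages → Pages) → Set
  Hits stamp h = ∀ {t p c s} → Lists stamp t c s → Unique (map page s) → p ∈ map page s →
    ∃[ s′ ] (Lists stamp (suc t) (touch t p c) s′ × map page s′ ≡ h p (map page s))

  simulation : ∀ stamp (h : Page → Pages → Pages) w → (∀ {p t} → stamp (entry p t t) ≡ t) → Hits stamp h →
    let policy = λ p c → if does (p ∈? c) then h p c else p ∷ take w c in
    Demand w policy →
    ∀ I {t c s} → Lists stamp t c s → Unique (map page s) → length (map page s) ≤ suc w →
    faultsFrom stamp (suc w) t c I ≡ faults policy (map page s) I
  simulation stamp h w stamped hits steps [] r s! s≤ = refl
  simulation stamp h w stamped hits steps (p ∷ I) {t} {c} {s} r s! s≤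
    with p ∈? map page s | steps p (map page s)
  ... | yes p∈ | step
    rewrite dec-true (any? (λ e → p ≟ page e) c) (Any.map⁻ (↭.∈-resp-↭ (↭-sym (↭.map⁺ page (ordering r))) p∈))
    with s′ , r′ , eq ← hits r s! p∈ =
    trans (simulation stamp h w stamped hits steps I r′
            (subst Unique (sym eq) (step-Unique step s!))
            (subst (λ c → length c ≤ suc w) (sym eq) (step-length step s≤)))
          (cong (λ c → faults _ c I) eq)
  ... | no p∉ | step
    rewrite dec-false (any? (λ e → p ≟ page e) c) (λ p∈ → p∉ (↭.∈-resp-↭ (↭.map⁺ page (ordering r)) (Any.map⁺ p∈)))
          | take-map {f = page} w s =
    cong suc (simulation stamp h w stamped hits steps I
      (load-Lists w stamped r s! (subst (_≤ suc w) (length-map page s) s≤))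
      (step-Unique step s!) (step-length step s≤))

  touchEntry : ℕ → Page → Entry → Entry
  touchEntry t p e = if does (p ≟ page e) then record e { lastRequested = t } else e

  touch-page : ∀ t p e → page (touchEntry t p e) ≡ page e
  touch-page t p e with does (p ≟ page e)
  ... | true  = refl
  ... | false = refl

  touch-entered : ∀ t p e → entered (touchEntry t p e) ≡ entered e
  touch-entered t p e with does (p ≟ page e)
  ... | true  = refl
  ... | false = refl

  fifo-Hits : Hits entered (λ _ c → c)
  fifo-Hits {t} {p} {c} {s} r _ _ = touch t p s , record
    { ordering   = ↭.map⁺ (touchEntry t p) (ordering r)
    ; decreasing = AllPairs.map⁺ (AllPairs.map (λ {e} {e′} lt →
        subst (_< _) (sym (touch-entered t p e′)) (subst (_ <_) (sym (touch-entered t p e)) lt)) (decreasing r))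
    ; past       = All.map⁺ (All.map (λ {e} lt →
        m<n⇒m<1+n (subst (_< t) (sym (touch-entered t p e)) lt)) (past r))
    } , trans (sym (map-∘ s)) (map-cong (touch-page t p) s)

  touch-∉ : ∀ t s → p ∉ map page s → touch t p s ≡ s
  touch-∉ t []      _  = refl
  touch-∉ {p} t (e ∷ s) p∉ with p ≟ page e
  ... | yes p≡e = contradiction (here p≡e) p∉
  ... | no _    = cong (e ∷_) (touch-∉ t s (p∉ ∘ there))

  -- Pages are distinct, so exactly one entry is touched; up to permutation it can be moved to the
  -- front, where its new stamp belongs in the LRU order.
  touch-↭ : ∀ t s → Unique (map page s) → p ∈ map page s →
    ∃[ e ] (page e ≡ p × lastRequested e ≡ t × touch t p s ↭ e ∷ dropPage p s)
  touch-↭ {p} t (e ∷ s) (e∉ ∷ s!) p∈ with p ≟ page e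
  touch-↭ t (e ∷ s) (e∉ ∷ s!) p∈ | yes refl =
    record e { lastRequested = t } , refl , refl ,
    ↭.prep _ (↭-reflexive (trans (touch-∉ t s p∉) (sym (trans (dropPage-self {s} e) (dropPage-∉ p∉)))))
    where
    p∉ : page e ∉ map page s
    p∉ p∈ = All.lookup e∉ p∈ refl
  touch-↭ t (e ∷ s) (e∉ ∷ s!) (here p≡e) | no p≢e = contradiction p≡e p≢e
  touch-↭ {p} t (e ∷ s) (e∉ ∷ s!) (there p∈) | no p≢e with page e ≟ p | touch-↭ t s s! p∈
  ... | yes e≡p | _ = contradiction (sym e≡p) p≢e
  ... | no _    | e′ , page≡ , last≡ , ↭ = e′ , page≡ , last≡ , ↭-trans (↭.prep e ↭) (↭.swap e e′ ↭-refl)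

  lru-Hits : Hits lastRequested (λ p c → p ∷ remove p c)
  lru-Hits {t} {p} {c} {s} r s! p∈ with touch-↭ t s s! p∈
  ... | e , refl , refl , ↭ = e ∷ dropPage p s , record
    { ordering   = ↭-trans (↭.map⁺ (touchEntry t p) (ordering r)) ↭
    ; decreasing = All.filter⁺ _ (past r) ∷ AllPairs.filter⁺ _ (decreasing r)
    ; past       = ≤-refl ∷ All.map m<n⇒m<1+n (All.filter⁺ _ (past r))
    } , cong (page e ∷_) (map-dropPage p s)

  FIFO≡ : ∀ w I → FIFO (suc w) I ≡ faults (fifo w) [] I
  FIFO≡ w I = simulation entered (λ _ c → c) w refl fifo-Hits (fifo-step w) I
    (record { ordering = ↭-refl ; decreasing = [] ; past = [] }) [] z≤n

  LRU≡ : ∀ w I → LRU (suc w) I ≡ faults (lru w) [] I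
  LRU≡ w I = simulation lastRequested (λ p c → p ∷ remove p c) w refl lru-Hits (lru-step w) I
    (record { ordering = ↭-refl ; decreasing = [] ; past = [] }) [] z≤n

-- Renaming pages, and attainment of the minimum and maximum.

module Renaming {Page : Set} (_≟_ : DecidableEquality Page) where

  open import Data.Nat.Base using (_+_)
  open Queues _≟_
  open Paging _≟_
  open import Data.List.Membership.DecPropositional _≟_ using (_∈?_)

  InjectiveOn : (Page → Page) → Pages → Set
  InjectiveOn ρ J = ∀ {x y} → x ∈ J → y ∈ J → ρ x ≡ ρ y → x ≡ y

  module _ {ρ : Page → Page} {J : Pages} (ρ-inj : InjectiveOn ρ J) where

    ∈-map-ρ⁻ : ∀ {p c} → p ∈ J → All (_∈ J) c → ρ p ∈ map ρ c → p ∈ c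
    ∈-map-ρ⁻ p∈J c⊆J ρp∈ with ∈-map⁻ ρ ρp∈
    ... | q , q∈c , ρp≡ρq = subst (_∈ _) (sym (ρ-inj p∈J (All.lookup c⊆J q∈c) ρp≡ρq)) q∈c

    miss-map : ∀ {p c} → p ∈ J → All (_∈ J) c → miss (ρ p) (map ρ c) ≡ miss p c
    miss-map {p} {c} p∈J c⊆J with p ∈? c
    ... | yes p∈c = miss-∈ (∈-map⁺ ρ p∈c)
    ... | no p∉c  = miss-∉ (p∉c ∘ ∈-map-ρ⁻ p∈J c⊆J)

    remove-map : ∀ {p c} → p ∈ J → All (_∈ J) c → remove (ρ p) (map ρ c) ≡ map ρ (remove p c)
    remove-map p∈J [] = refl
    remove-map {p} {x ∷ c} p∈J (x∈J ∷ c⊆J) with x ≟ p | ρ x ≟ ρ p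
    ... | yes _    | yes _     = remove-map p∈J c⊆J
    ... | no _     | no _      = cong (ρ x ∷_) (remove-map p∈J c⊆J)
    ... | yes refl | no ρx≢ρx  = contradiction refl ρx≢ρx
    ... | no x≢p   | yes ρx≡ρp = contradiction (ρ-inj x∈J p∈J ρx≡ρp) x≢p

    Equivariant : Policy → Set
    Equivariant s = ∀ {p c} → p ∈ J → All (_∈ J) c → s (ρ p) (map ρ c) ≡ map ρ (s p c)

    fifo-map : ∀ w → Equivariant (fifo w)
    fifo-map w {p} {c} p∈J c⊆J with p ∈? c | ρ p ∈? map ρ c
    ... | yes _   | yes _   = refl
    ... | no _    | no _    = cong (ρ p ∷_) (take-map w c)
    ... | yes p∈c | no ρp∉  = contradiction (∈-map⁺ ρ p∈c) ρp∉
    ... | no p∉c  | yes ρp∈ = contradiction (∈-map-ρ⁻ p∈J c⊆J ρp∈) p∉c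

    lru-map : ∀ w → Equivariant (lru w)
    lru-map w {p} {c} p∈J c⊆J with p ∈? c | ρ p ∈? map ρ c
    ... | yes _   | yes _   = cong (ρ p ∷_) (remove-map p∈J c⊆J)
    ... | no _    | no _    = cong (ρ p ∷_) (take-map w c)
    ... | yes p∈c | no ρp∉  = contradiction (∈-map⁺ ρ p∈c) ρp∉
    ... | no p∉c  | yes ρp∈ = contradiction (∈-map-ρ⁻ p∈J c⊆J ρp∈) p∉c

    -- Injectivity on `J` is enough because a demand policy only ever caches pages that were
    -- requested or cached at the start.
    faults-map : ∀ {w s} → Demand w s → Equivariant s →
      ∀ {I c} → All (_∈ J) I → All (_∈ J) c → faults s (map ρ c) (map ρ I) ≡ faults s c I
    faults-map s-step s-map [] _ = refl
    faults-map {w} {s} s-step s-map {p ∷ I} {c} (p∈J ∷ I⊆J) c⊆J = cong₂ _+_ (miss-map p∈J c⊆J)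
      (trans (cong (λ c → faults s c (map ρ I)) (s-map p∈J c⊆J))
             (faults-map s-step s-map I⊆J (All.tabulate λ x∈ → All.lookup (p∈J ∷ c⊆J) (step-⊆ (s-step p c) x∈))))

  position : Page → Pages → ℕ
  position p []      = 0
  position p (x ∷ I) with p ≟ x
  ... | yes _ = 0
  ... | no _  = suc (position p I)

  position-< : ∀ {p I} → p ∈ I → position p I < length I
  position-< {p} {x ∷ I} p∈ with p ≟ x
  ... | yes _ = s≤s z≤n
  position-< {p} {x ∷ I} (here p≡x) | no p≢x = contradiction p≡x p≢x
  position-< {p} {x ∷ I} (there p∈) | no _   = s≤s (position-< p∈)

  position-injective : ∀ {p q I} → p ∈ I → q ∈ I → position p I ≡ position q I → p ≡ q
  position-injective {p} {q} {x ∷ I} p∈ q∈ eq with p ≟ x | q ≟ x | p∈ | q∈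
  ... | yes p≡x | yes q≡x | _ | _ = trans p≡x (sym q≡x)
  ... | no p≢x  | no _    | here p≡x | _ = contradiction p≡x p≢x
  ... | no _    | no q≢x  | _ | here q≡x = contradiction q≡x q≢x
  ... | no _    | no _    | there p∈I | there q∈I = position-injective p∈I q∈I (suc-injective eq)

  words : Pages → ℕ → List Pages
  words X zero    = [] ∷ []
  words X (suc n) = cartesianProductWith _∷_ X (words X n)

  ∈-words⁺ : ∀ {X I} → All (_∈ X) I → I ∈ words X (length I)
  ∈-words⁺ []          = here refl
  ∈-words⁺ (x∈X ∷ I⊆X) = ∈-cartesianProductWith⁺ _∷_ x∈X (∈-words⁺ I⊆X)

  ∈-words⁻ : ∀ X n {I} → I ∈ words X n → length I ≡ n
  ∈-words⁻ X zero    (here refl) = refl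
  ∈-words⁻ X (suc n) I∈ with ∈-cartesianProductWith⁻ _∷_ X (words X n) I∈
  ... | _ , _ , _ , J∈ , refl = cong suc (∈-words⁻ X n J∈)

  Renamable : (Requests → ℤ) → Set
  Renamable D = ∀ {ρ I} → InjectiveOn ρ I → D (map ρ I) ≡ D I

  module _ (ι : ℕ → Page) (ι-inj : ∀ {i j} → ι i ≡ ι j → i ≡ j) where

    candidates : ℕ → List Pages
    candidates n = words (applyUpTo ι n) n

    -- Each page is renamed according to its first position in `I`. At most `n` names occur, which
    -- reduces the infinitely many sequences of length `n` to a finite list.
    candidates-suffice : ∀ {D} → Renamable D → ∀ {n} I → length I ≡ n → ∃[ J ] (J ∈ candidates n × D J ≡ D I)
    candidates-suffice D-ren I refl = map ρ I ,
      subst (λ n → map ρ I ∈ words (applyUpTo ι (length I)) n) (length-map ρ I) (∈-words⁺ ρI⊆) ,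
      D-ren (λ x∈ y∈ eq → position-injective x∈ y∈ (ι-inj eq))
      where
      ρ : Page → Page
      ρ p = ι (position p I)
      ρI⊆ : All (_∈ applyUpTo ι (length I)) (map ρ I)
      ρI⊆ = All.tabulate λ x∈ → let q , q∈ , eq = ∈-map⁻ ρ x∈ in
        subst (_∈ _) (sym eq) (∈-applyUpTo⁺ ι (position-< q∈))

    -- The default `replicate n (ι 0)` has length `n` like the candidates, so the chosen sequence
    -- has this length in either case.
    minimiser maximiser : (Requests → ℤ) → ℕ → Pages
    minimiser D n = argmin D (replicate n (ι 0)) (candidates n)
    maximiser D n = argmax D (replicate n (ι 0)) (candidates n)

    length-minimiser : ∀ D n → length (minimiser D n) ≡ n
    length-minimiser D n = argmin-all D {P = λ I → length I ≡ n} (length-replicate n)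
      (All.tabulate (∈-words⁻ _ n))

    length-maximiser : ∀ D n → length (maximiser D n) ≡ n
    length-maximiser D n = argmax-all D {P = λ I → length I ≡ n} (length-replicate n)
      (All.tabulate (∈-words⁻ _ n))

    minimal : ∀ {D} → Renamable D → ∀ n I → length I ≡ n → D (minimiser D n) ℤ.≤ D I
    minimal {D} D-ren n I len with candidates-suffice D-ren I len
    ... | J , J∈ , DJ≡DI = subst (D (minimiser D n) ℤ.≤_) DJ≡DI (All.lookup (f[argmin]≤f[xs] _ (candidates n)) J∈)

    maximal : ∀ {D} → Renamable D → ∀ n I → length I ≡ n → D I ℤ.≤ D (maximiser D n)
    maximal {D} D-ren n I len with candidates-suffice D-ren I len
    ... | J , J∈ , DJ≡DI = subst (ℤ._≤ D (maximiser D n)) DJ≡DI (All.lookup (f[xs]≤f[argmax] _ (candidates n)) J∈)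

    -- The extremal sequences inherit the bounds that hold for all sequences. Conversely, at the
    -- length of a witness the minimum is at most, and the maximum at least, the value of the
    -- witness.
    relativeInterval : ∀ A B → Renamable (difference A B) → ∀ a a′ b b′ C C′ .{{_ : NonZero b}} .{{_ : NonZero b′}} →
      (∀ I → Above a b C (length I) (difference A B I)) →
      (∀ N → ∃[ I ] (N ≤ length I × Below a b C (length I) (difference A B I))) →
      (∀ I → Below a′ b′ C′ (length I) (difference A B I)) →
      (∀ N → ∃[ I ] (N ≤ length I × Above a′ b′ C′ (length I) (difference A B I))) →
      RelativeInterval A B (a ℚ./ b) (a′ ℚ./ b′)
    relativeInterval A B D-ren a a′ b b′ C C′ {{b≢0}} {{b′≢0}} above below′ below above′ =
      ( (λ n → D (minimiser D n))
      , (λ n → (minimiser D n , length-minimiser D n , refl) , minimal D-ren n)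
      , liminf a b C
          (λ n → subst (λ m → Above a b C m (D (minimiser D n))) (length-minimiser D n) (above (minimiser D n)))
          (λ N → let I , N≤ , bI = below′ N in length I , N≤ ,
            ℤ.≤-trans (ℤ.*-monoˡ-≤-nonNeg (+ b) (minimal D-ren (length I) I refl)) bI) ) ,
      ( (λ n → D (maximiser D n))
      , (λ n → (maximiser D n , length-maximiser D n , refl) , maximal D-ren n)
      , limsup a′ b′ C′
          (λ n → subst (λ m → Below a′ b′ C′ m (D (maximiser D n))) (length-maximiser D n) (below (maximiser D n)))
          (λ N → let I , N≤ , aI = above′ N in length I , N≤ ,
            ℤ.≤-trans aI (ℤ.*-monoˡ-≤-nonNeg (+ b′) (maximal D-ren (length I) I refl))) )
      where
      D = difference A B

-- Both endpoints of the interval, up to an additive constant in the faults.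

module Interval {Page : Set} (_≟_ : DecidableEquality Page) (w : ℕ) where

  open import Data.Nat.Base using (_+_)
  open Queues _≟_
  open RequestSequences _≟_
  open Simulation _≟_
  open Renaming _≟_
  open Paging _≟_

  -- `K` is 2k - 1, the denominator of the upper endpoint w / (2k - 1).
  k K : ℕ
  k = suc w
  K = suc (w + w)

  F L : Requests → ℕ
  F = faults (fifo w) []
  L = faults (lru w) []

  F≤ : ∀ I → F I ≤ k * L I + k
  F≤ I = competitive w (fifo-step w) (lru-step w) I [] z≤n z≤n

  L≤ : ∀ I → L I ≤ k * F I + k
  L≤ I = competitive w (lru-step w) (fifo-step w) I [] z≤n z≤n

  2F≤ : ∀ I → F I + F I ≤ length I + L I
  2F≤ I = ≤-trans (fifo-hits w I {[]} [] [] z≤n (record { evicted = λ () ; ordered = λ _ () }))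
                  (≤-reflexive (+-identityʳ _))

  lower : ∀ {C} → k ≤ C → ∀ I → k * L I + 0 ≤ k * F I + (w * length I + C)
  lower {C} k≤C I = begin
    k * L I + 0                       ≡⟨ +-identityʳ _ ⟩
    -- One copy of `L I` is bounded by competitiveness, the other `w` copies by the number of
    -- requests.
    L I + w * L I                     ≤⟨ +-mono-≤ (L≤ I) (*-monoʳ-≤ w (faults≤length (lru w) [] I)) ⟩
    k * F I + k + w * length I        ≤⟨ +-monoˡ-≤ (w * length I) (+-monoʳ-≤ (k * F I) k≤C) ⟩
    k * F I + C + w * length I        ≡⟨ +-assoc (k * F I) C _ ⟩
    k * F I + (C + w * length I)      ≡⟨ cong (λ m → k * F I + m) (+-comm C _) ⟩
    k * F I + (w * length I + C)      ∎
    where open ≤-Reasoning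

  upper : ∀ {C} → k ≤ C → ∀ I → K * F I + 0 ≤ K * L I + (w * length I + C)
  upper {C} k≤C I = begin
    K * F I + 0                                  ≡⟨ eq₁ w (F I) ⟩
    -- The weights are chosen so that the coefficients of `L I` on the right, `w` and `k`, add up to
    -- `K`.
    w * (F I + F I) + F I                        ≤⟨ +-mono-≤ (*-monoʳ-≤ w (2F≤ I)) (≤-trans (F≤ I) (+-monoʳ-≤ (k * L I) k≤C)) ⟩
    w * (length I + L I) + (k * L I + C)         ≡⟨ eq₂ w (length I) (L I) C ⟩
    K * L I + (w * length I + C)                 ∎
    where
    open ≤-Reasoning
    eq₁ : ∀ w f → suc (w + w) * f + 0 ≡ w * (f + f) + f
    eq₁ = ℕ.solve-∀
    eq₂ : ∀ w n l c → w * (n + l) + (suc w * l + c) ≡ suc (w + w) * l + (w * n + c)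
    eq₂ = ℕ.solve-∀

  module _ {f : ℕ → Page} (f! : Distinct f) (j : ℕ) where

    minRequests maxRequests : Requests
    minRequests = minPrefix w f ++ rounds (minRound w) f j
    maxRequests = maxPrefix w f ++ rounds (maxRound w) f j

    private
      afterPrefix : ∀ s {c} I J m → run s [] I ≡ c → faults s c J ≡ m →
        faults s [] (I ++ J) ≡ faults s [] I + m
      afterPrefix s I J m refl refl = faults-++ s I J

    length-maxPrefix : length (maxPrefix w f) ≡ k
    length-maxPrefix = trans (length-reverse (window w f)) (length-applyUpTo f k)

    length-minPrefix : length (minPrefix w f) ≡ k + k
    length-minPrefix = trans (length-++ (window w f)) (cong₂ _+_ (length-applyUpTo f k) length-maxPrefix)

    length-minRequests : length minRequests ≡ k + k + j * k
    length-minRequests = trans (length-++ (minPrefix w f))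
      (cong₂ _+_ length-minPrefix (length-rounds k (length-minRound w) f j))

    length-maxRequests : length maxRequests ≡ k + j * (w + k)
    length-maxRequests = trans (length-++ (maxPrefix w f))
      (cong₂ _+_ length-maxPrefix (length-rounds (w + k) (length-maxRound w) f j))

    -- Each round balances exactly, as `k * 1 + w * k` equals `k * k`. The constant comes from the
    -- prefix: the faults of FIFO there are bounded by its length `k + k`, and those of LRU are
    -- dropped.
    minRequests-≤ : k * F minRequests + w * length minRequests ≤ k * L minRequests + (k * (k + k) + w * (k + k))
    minRequests-≤ = begin
      k * F minRequests + w * length minRequests
        ≡⟨ cong₂ (λ m n → k * m + w * n) F≡ length-minRequests ⟩
      k * (F₀ + j * 1) + w * (k + k + j * k)
        ≤⟨ +-monoˡ-≤ _ (*-monoʳ-≤ k (+-monoˡ-≤ (j * 1) F₀≤)) ⟩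
      k * (k + k + j * 1) + w * (k + k + j * k)
        ≡⟨ eq w (k + k) j ⟩
      k * (j * k) + (k * (k + k) + w * (k + k))
        ≤⟨ +-monoˡ-≤ _ (*-monoʳ-≤ k (m≤n+m (j * k) L₀)) ⟩
      k * (L₀ + j * k) + (k * (k + k) + w * (k + k))
        ≡⟨ cong (λ m → k * m + (k * (k + k) + w * (k + k))) L≡ ⟨
      k * L minRequests + (k * (k + k) + w * (k + k)) ∎
      where
      open ≤-Reasoning
      F₀ = F (minPrefix w f)
      L₀ = L (minPrefix w f)
      F≡ : F minRequests ≡ F₀ + j * 1
      F≡ = afterPrefix (fifo w) (minPrefix w f) _ _ (fifo-minPrefix w f!)
        (rounds-run {state = reverse ∘ window w} 1 (fifo-minRound w) f! j)
      L≡ : L minRequests ≡ L₀ + j * k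
      L≡ = afterPrefix (lru w) (minPrefix w f) _ _ (lru-minPrefix w f!)
        (rounds-run {state = window w} k (cycle-round w (lru-step w)) f! j)
      F₀≤ : F₀ ≤ k + k
      F₀≤ = ≤-trans (faults≤length (fifo w) [] (minPrefix w f)) (≤-reflexive length-minPrefix)
      eq : ∀ w m j → suc w * (m + j * 1) + w * (m + j * suc w) ≡ suc w * (j * suc w) + (suc w * m + w * m)
      eq = ℕ.solve-∀

    -- A round has `w + k`, that is `K`, requests, and `K * 1 + w * K` equals `K * k`; the constant
    -- again comes from the prefix.
    maxRequests-≤ : K * L maxRequests + w * length maxRequests ≤ K * F maxRequests + (K * k + w * k)
    maxRequests-≤ = begin
      K * L maxRequests + w * length maxRequests
        ≡⟨ cong₂ (λ m n → K * m + w * n) L≡ length-maxRequests ⟩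
      K * (L₀ + j * 1) + w * (k + j * (w + k))
        ≤⟨ +-monoˡ-≤ _ (*-monoʳ-≤ K (+-monoˡ-≤ (j * 1) L₀≤)) ⟩
      K * (k + j * 1) + w * (k + j * (w + k))
        ≡⟨ eq w j ⟩
      K * (j * k) + (K * k + w * k)
        ≤⟨ +-monoˡ-≤ _ (*-monoʳ-≤ K (m≤n+m (j * k) F₀)) ⟩
      K * (F₀ + j * k) + (K * k + w * k)
        ≡⟨ cong (λ m → K * m + (K * k + w * k)) F≡ ⟨
      K * F maxRequests + (K * k + w * k) ∎
      where
      open ≤-Reasoning
      F₀ = F (maxPrefix w f)
      L₀ = L (maxPrefix w f)
      F≡ : F maxRequests ≡ F₀ + j * k
      F≡ = afterPrefix (fifo w) (maxPrefix w f) _ _ (maxPrefix-run w (fifo-step w) f!)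
        (rounds-run {state = window w} k (fifo-maxRound w) f! j)
      L≡ : L maxRequests ≡ L₀ + j * 1
      L≡ = afterPrefix (lru w) (maxPrefix w f) _ _ (maxPrefix-run w (lru-step w) f!)
        (rounds-run {state = window w} 1 (lru-maxRound w) f! j)
      L₀≤ : L₀ ≤ k
      L₀≤ = ≤-trans (faults≤length (lru w) [] (maxPrefix w f)) (≤-reflexive length-maxPrefix)
      eq : ∀ w j → suc (w + w) * (suc w + j * 1) + w * (suc w + j * (w + suc w))
        ≡ suc (w + w) * (j * suc w) + (suc (w + w) * suc w + w * suc w)
      eq = ℕ.solve-∀

  difference≡ : ∀ I → difference (FIFO k) (LRU k) I ≡ F I ℤ.⊖ L I
  difference≡ I = cong₂ ℤ._⊖_ (FIFO≡ w I) (LRU≡ w I)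

  difference-renamable : Renamable (difference (FIFO k) (LRU k))
  difference-renamable {ρ} {I} ρ-inj = trans (difference≡ (map ρ I)) (trans
    (cong₂ ℤ._⊖_ (faults-map ρ-inj (fifo-step w) (fifo-map ρ-inj w) I⊆I [])
                 (faults-map ρ-inj (lru-step w) (lru-map ρ-inj w) I⊆I []))
    (sym (difference≡ I)))
    where
    I⊆I = All.tabulate λ x∈ → x∈

  interval : ∀ {f : ℕ → Page} → Distinct f →
    RelativeInterval (FIFO k) (LRU k) ((ℤ.- + w) ℚ./ k) (+ w ℚ./ K)
  interval {f} f! = relativeInterval f f! (FIFO k) (LRU k) difference-renamable (ℤ.- + w) (+ w) k K C C′
    (λ I → subst₂ ℤ._≤_ (neg-sum (length I) C) (D I k)
      (≤⇒≤-⊖ k (L I) (F I) (lower k≤C I)))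
    (λ N → minRequests f! N ,
      ≤-trans (≤-trans (m≤m*n N k) (m≤n+m (N * k) (k + k)))
              (≤-reflexive (sym (length-minRequests f! N))) ,
      subst₂ ℤ._≤_ (D (minRequests f! N) k) (neg-diff (length (minRequests f! N)) C)
        (≤⇒⊖-≤ k (F (minRequests f! N)) (L (minRequests f! N)) (minRequests-≤ f! N)))
    (λ I → subst₂ ℤ._≤_ (D I K) (pos-sum (length I) C′)
      (≤⇒⊖-≤ K (F I) (L I) (upper k≤C′ I)))
    (λ N → maxRequests f! N ,
      ≤-trans (≤-trans (m≤m*n N (w + k) {{wk≢0}}) (m≤n+m (N * (w + k)) k))
              (≤-reflexive (sym (length-maxRequests f! N))) ,
      subst₂ ℤ._≤_ (cong (ℤ._- + C′) (ℤ.pos-* w (length (maxRequests f! N)))) (D (maxRequests f! N) K)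
        (≤⇒≤-⊖ K (L (maxRequests f! N)) (F (maxRequests f! N)) (maxRequests-≤ f! N)))
    where
    -- The constants of the witnesses exceed the additive `k` of the universal bounds, so one
    -- constant serves both directions.
    C C′ : ℕ
    C = k * (k + k) + w * (k + k)
    C′ = K * k + w * k
    k≤C : k ≤ C
    k≤C = ≤-trans (m≤m*n k (k + k)) (m≤m+n _ _)
    k≤C′ : k ≤ C′
    k≤C′ = ≤-trans (m≤n*m k K) (m≤m+n _ _)
    wk≢0 : NonZero (w + k)
    wk≢0 = subst NonZero (sym (+-suc w w)) _
    D : ∀ I b → + b ℤ.* (F I ℤ.⊖ L I) ≡ + b ℤ.* difference (FIFO k) (LRU k) I
    D I b = cong (+ b ℤ.*_) (sym (difference≡ I))
    neg-sum : ∀ n C → + 0 ℤ.- + (w * n + C) ≡ ℤ.- + w ℤ.* + n ℤ.- + C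
    neg-sum n C = trans (cong (λ m → + 0 ℤ.- (m ℤ.+ + C)) (ℤ.pos-* w n)) (lemma (+ w) (+ n) (+ C))
      where
      lemma : ∀ w n C → + 0 ℤ.- (w ℤ.* n ℤ.+ C) ≡ ℤ.- w ℤ.* n ℤ.- C
      lemma = ℤ.solve-∀
    neg-diff : ∀ n C → + C ℤ.- + (w * n) ≡ ℤ.- + w ℤ.* + n ℤ.+ + C
    neg-diff n C = trans (cong (λ m → + C ℤ.- m) (ℤ.pos-* w n)) (lemma (+ w) (+ n) (+ C))
      where
      lemma : ∀ w n C → C ℤ.- w ℤ.* n ≡ ℤ.- w ℤ.* n ℤ.+ C
      lemma = ℤ.solve-∀
    pos-sum : ∀ n C → + (w * n + C) ℤ.- + 0 ≡ + w ℤ.* + n ℤ.+ + C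
    pos-sum n C = trans (ℤ.+-identityʳ _) (cong (ℤ._+ + C) (ℤ.pos-* w n))

-- The endpoints in their stated form.

lo≡ : ∀ w → ℚ.- 1ℚ ℚ.+ (+ 1 ℚ./ suc w) ≡ (ℤ.- + w) ℚ./ suc w
lo≡ w = ℚ.toℚᵘ-injective (ℚᵘ.≃-trans (ℚ.toℚᵘ-homo-+ (ℚ.- 1ℚ) (+ 1 ℚ./ suc w))
  (ℚᵘ.≃-trans (ℚᵘ.+-congʳ (toℚᵘ (ℚ.- 1ℚ)) (toℚᵘ-/ (+ 1) w))
  (ℚᵘ.≃-trans (ℚᵘ.*≡* (cross (+ w))) (ℚᵘ.≃-sym (toℚᵘ-/ (ℤ.- + w) w)))))
  where
  cross : ∀ w → (-[1+ 0 ] ℤ.* (+ 1 ℤ.+ w) ℤ.+ + 1 ℤ.* + 1) ℤ.* (+ 1 ℤ.+ w) ≡ ℤ.- w ℤ.* (+ 1 ℤ.* (+ 1 ℤ.+ w))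
  cross = ℤ.solve-∀

-- With K = 2w + 1 this is 1/2 - 1/(2K) = (K - 1)/(2K). The variable `m` stands for `4 * k ∸ 2`, so
-- that matching on the equation removes the truncated subtraction from the denominator.
hi≡ : ∀ w {m} .{{_ : NonZero m}} → m ≡ suc (suc (w ℕ.+ w ℕ.+ (w ℕ.+ w))) → ½ ℚ.- (+ 1 ℚ./ m) ≡ + w ℚ./ suc (w ℕ.+ w)
hi≡ w {m} refl = ℚ.toℚᵘ-injective (ℚᵘ.≃-trans (ℚ.toℚᵘ-homo-+ ½ (ℚ.- (+ 1 ℚ./ m)))
  (ℚᵘ.≃-trans (ℚᵘ.+-congʳ (toℚᵘ ½)
    (ℚᵘ.≃-trans (ℚ.toℚᵘ-homo‿- (+ 1 ℚ./ m)) (ℚᵘ.-‿cong (toℚᵘ-/ (+ 1) (suc (w ℕ.+ w ℕ.+ (w ℕ.+ w)))))))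
  (ℚᵘ.≃-trans (ℚᵘ.*≡* (cross (+ w))) (ℚᵘ.≃-sym (toℚᵘ-/ (+ w) (w ℕ.+ w))))))
  where
  cross : ∀ w → (+ 1 ℤ.* (+ 2 ℤ.+ (w ℤ.+ w ℤ.+ (w ℤ.+ w))) ℤ.+ -[1+ 0 ] ℤ.* + 2) ℤ.* (+ 1 ℤ.+ (w ℤ.+ w))
    ≡ w ℤ.* (+ 2 ℤ.* (+ 2 ℤ.+ (w ℤ.+ w ℤ.+ (w ℤ.+ w))))
  cross = ℤ.solve-∀

4k∸2≡ : ∀ w → 4 * suc w ∸ 2 ≡ suc (suc (w ℕ.+ w ℕ.+ (w ℕ.+ w)))
4k∸2≡ w = trans (cong (_∸ 2) (*-suc 4 w)) (cong (suc ∘ suc) (eq w))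
  where
  eq : ∀ w → 4 * w ≡ w ℕ.+ w ℕ.+ (w ℕ.+ w)
  eq = ℕ.solve-∀

open import Data.Rational.Base using (_/_; -_; _+_; _-_)

theorem1 : {Page : Set} (_≟_ : DecidableEquality Page) → ℕ ↣ Page →
    (k : ℕ) → .{{_ : NonZero k}} →
    let open Paging _≟_ in
    RelativeInterval (FIFO k) (LRU k)
    (- 1ℚ + (+ 1 / k))
    (½ - (+ 1 / (4 * k ∸ 2)))
theorem1 _≟_ ι (suc w) = subst₂ (RelativeInterval (FIFO (suc w)) (LRU (suc w)))
  (sym (lo≡ w)) (sym (hi≡ w (4k∸2≡ w)))
  (Interval.interval _≟_ w (Injection.injective ι))
  where open Paging _≟_
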